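{- In the setting of the context, assume moreover that $D$ has the finite norm property (i.e. $D/I$ is finite for every nonzero ideal $I$ of $D$). Then the number of polynomial functions $\mathcal{D}_{I_1}\times\cdots\times\mathcal{D}_{I_r}\to D/J$ equals $$N(I_1,\ldots,I_r;J)=\prod_{\mathbf{k}}\Big|\big(v_{k_1}(X_1)\cdots v_{k_r}(X_r)+\bar J\big)/\bar J\Big|,$$ where the product runs over all $\mathbf{k}=(k_1,\ldots,k_r)\in\mathbb{N}^r$ with $0\le k_i\le\mu(I_i,J)-1$ for each $1\le i\le r$.
   Context: $D$ is a Dedekind domain, $r\ge1$, and $I_1,\ldots,I_r,J$ are ideals of $D$ different from $0$ and $D$. For each $i$ a complete set of residues $\mathcal{D}_{I_i}\subseteq D$ modulo $I_i$ with $0\in\mathcal{D}_{I_i}$ is fixed, identified with $D/I_i$. Let $K=I_1\cap\cdots\cap I_r\cap J$, $R=D/K$, and $\bar I=I/K$ for ideals $I\supseteq K$, so $R/\bar J=D/J$. Let $X_i\subseteq R$ be the image of $\mathcal{D}_{I_i}$ in $R$. Write $K=P_1^{e_1}\cdots P_n^{e_n}$; the nonzero primes of $R$ are $\bar P_1,\ldots,\bar P_n$. For a nonzero prime $\bar P$ of $R$ and $a\in R$, $w_{\bar P}(a)$ is the highest power of $\bar P$ containing $a$ ($w_{\bar P}(0)=0$). A $\bar P$-ordering of $X\subseteq R$ is a sequence $b_0,b_1,\ldots$ in $X$, $b_0$ arbitrary, with each $b_k$ chosen to make $w_{\bar P}((b_k-b_0)\cdots(b_k-b_{k-1}))$ as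 large as possible; $v_0(X,\bar P)=R$, $v_k(X,\bar P)=w_{\bar P}((b_k-b_0)\cdots(b_k-b_{k-1}))$ for $k\ge1$ (independent of the ordering), and $v_k(X)=\prod_{l=1}^n v_k(X,\bar P_l)$. $\mu(I_i,J)$ is the smallest positive integer $k$ with $v_k(X_i)\subseteq\bar J$ if it exists, and $|D/I_i|$ otherwise. A function $f:\mathcal{D}_{I_1}\times\cdots\times\mathcal{D}_{I_r}\to D/J$ is a polynomial function if some $F\in D[x_1,\ldots,x_r]$ satisfies $F(b)\equiv f(b)\pmod J$ for all $b\in\mathcal{D}_{I_1}\times\cdots\times\mathcal{D}_{I_r}$. -}

module Defs where

open import Algebra.Bundles using (CommutativeRing; Semiring)
open import Data.Fin.Base using (Fin; toℕ)
open import Data.List.Base as List using (List; []; _∷_; [_])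
open import Data.Nat.Base as ℕ using (ℕ; zero; suc; _∸_)
open import Data.Nat.ListAction using (product)
open import Data.Product.Base using (Σ; ∃; ∃-syntax; _×_; _,_; proj₁; proj₂)
open import Data.Sum.Base using (_⊎_)
open import Data.Unit.Polymorphic.Base using (⊤; tt)
open import Data.Vec.Base as Vec using (Vec; lookup)
open import Data.Vec.Functional as Vector using (Vector)
open import Function.Bundles using (Func; _⟨$⟩_; Inverse)
open import Level using (Level; _⊔_; Lift; lift) renaming (suc to lsuc)
open import Relation.Binary.Bundles using (Setoid)
open import Relation.Binary.PropositionalEquality.Core as ≡ using (_≡_)
open import Relation.Nullary.Negation.Core using (¬_)
open import Relation.Unary using (Pred; _∈_; _⊆_; _⊂_; _≐_)
import Algebra.Properties.CommutativeSemigroup as CommutativeSemigroupProperties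
import Algebra.Properties.Ring as RingProperties
import Algebra.Definitions.RawSemiring as RawSemiringDefinitions
import Data.Vec.Functional.Relation.Binary.Equality.Setoid as VectorEquality
import Function.Relation.Binary.Setoid.Equality as FuncEquality
import Relation.Binary.Construct.On as On
import Relation.Binary.PropositionalEquality.Properties as ≡ₚ

HasCardinality : ∀ {a b} → Setoid a b → ℕ → Set (a ⊔ b)
HasCardinality S n = Inverse S (≡ₚ.setoid (Fin n))

-- The vectors k with 0 ≤ kᵢ < mᵢ, each listed once.
box : ∀ {r} → Vec ℕ r → List (Vec ℕ r)
box Vec.[]       = [ Vec.[] ]
box (m Vec.∷ ms) = List.cartesianProductWith Vec._∷_ (List.upTo m) (box ms)

module Ideals {c ℓ : Level} (R : CommutativeRing c ℓ) where

  open CommutativeRing R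
  open RawSemiringDefinitions (Semiring.rawSemiring semiring) using (sum; _^_) renaming (product to ∏)

  record Ideal : Set (lsuc (c ⊔ ℓ)) where
    field
      members  : Pred Carrier (c ⊔ ℓ)
      respects : ∀ {x y} → x ≈ y → x ∈ members → y ∈ members
      0∈       : 0# ∈ members
      +-closed : ∀ {x y} → x ∈ members → y ∈ members → x + y ∈ members
      *-closed : ∀ a {x} → x ∈ members → a * x ∈ members

  ⟦_⟧ : Ideal → Pred Carrier (c ⊔ ℓ)
  ⟦_⟧ = Ideal.members

  infix 4 _≐ᵢ_ _⊆ᵢ_

  _⊆ᵢ_ : Ideal → Ideal → Set (c ⊔ ℓ)
  I ⊆ᵢ J = ⟦ I ⟧ ⊆ ⟦ J ⟧

  _≐ᵢ_ : Ideal → Ideal → Set (c ⊔ ℓ)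
  I ≐ᵢ J = ⟦ I ⟧ ≐ ⟦ J ⟧

  0ᵢ : Ideal
  0ᵢ = record
    { members  = λ x → Lift c (x ≈ 0#)
    ; respects = λ { x≈y (lift x≈0) → lift (trans (sym x≈y) x≈0) }
    ; 0∈       = lift refl
    ; +-closed = λ { (lift p) (lift q) → lift (trans (+-cong p q) (+-identityˡ 0#)) }
    ; *-closed = λ { a (lift p) → lift (trans (*-congˡ p) (zeroʳ a)) }
    }

  1ᵢ : Ideal
  1ᵢ = record
    { members  = λ _ → ⊤
    ; respects = λ _ _ → tt
    ; 0∈       = tt
    ; +-closed = λ _ _ → tt
    ; *-closed = λ _ _ → tt
    }

  infixr 7 _∩ᵢ_ _·ᵢ_
  infixl 6 _+ᵢ_
  infixr 8 _^ᵢ_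

  _∩ᵢ_ : Ideal → Ideal → Ideal
  I ∩ᵢ J = record
    { members  = λ x → x ∈ ⟦ I ⟧ × x ∈ ⟦ J ⟧
    ; respects = λ { e (p , q) → I.respects e p , J.respects e q }
    ; 0∈       = I.0∈ , J.0∈
    ; +-closed = λ { (p , q) (p′ , q′) → I.+-closed p p′ , J.+-closed q q′ }
    ; *-closed = λ { a (p , q) → I.*-closed a p , J.*-closed a q }
    } where
      module I = Ideal I
      module J = Ideal J

  ⋂ᵢ : ∀ {n} → Vector Ideal n → Ideal
  ⋂ᵢ = Vector.foldr _∩ᵢ_ 1ᵢ

  _+ᵢ_ : Ideal → Ideal → Ideal
  I +ᵢ J = record
    { members  = λ x → ∃[ a ] ∃[ b ] a ∈ ⟦ I ⟧ × b ∈ ⟦ J ⟧ × x ≈ a + b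
    ; respects = λ { e (a , b , p , q , r) → a , b , p , q , trans (sym e) r }
    ; 0∈       = 0# , 0# , I.0∈ , J.0∈ , sym (+-identityˡ 0#)
    ; +-closed = λ { (a , b , p , q , r) (a′ , b′ , p′ , q′ , r′) →
        a + a′ , b + b′ , I.+-closed p p′ , J.+-closed q q′ ,
        trans (+-cong r r′) (interchange a b a′ b′) }
    ; *-closed = λ { d (a , b , p , q , r) →
        d * a , d * b , I.*-closed d p , J.*-closed d q ,
        trans (*-congˡ r) (distribˡ d a b) }
    } where
      module I = Ideal I
      module J = Ideal J
      open CommutativeSemigroupProperties +-commutativeSemigroup using (interchange)

  -- Finite sums of products a * b with a ∈ I and b ∈ J.
  data ProductMember (I J : Ideal) : Pred Carrier (c ⊔ ℓ) where
    empty : ∀ {x} → x ≈ 0# → ProductMember I J x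
    add   : ∀ {x a b y} → a ∈ ⟦ I ⟧ → b ∈ ⟦ J ⟧ → ProductMember I J y →
            x ≈ a * b + y → ProductMember I J x

  _·ᵢ_ : Ideal → Ideal → Ideal
  I ·ᵢ J = record
    { members  = ProductMember I J
    ; respects = resp
    ; 0∈       = empty refl
    ; +-closed = plus
    ; *-closed = times
    } where
      resp : ∀ {x y} → x ≈ y → ProductMember I J x → ProductMember I J y
      resp e (empty p)     = empty (trans (sym e) p)
      resp e (add p q m r) = add p q m (trans (sym e) r)

      plus : ∀ {x y} → ProductMember I J x → ProductMember I J y → ProductMember I J (x + y)
      plus (empty p)     n = resp (sym (trans (+-congʳ p) (+-identityˡ _))) n
      plus (add p q m r) n = add p q (plus m n) (trans (+-congʳ r) (+-assoc _ _ _))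

      times : ∀ d {x} → ProductMember I J x → ProductMember I J (d * x)
      times d (empty p)     = empty (trans (*-congˡ p) (zeroʳ d))
      times d (add p q m r) = add (Ideal.*-closed I d p) q (times d m)
        (trans (*-congˡ r) (trans (distribˡ d _ _) (+-congʳ (sym (*-assoc d _ _)))))

  ∏ᵢ : ∀ {n} → Vector Ideal n → Ideal
  ∏ᵢ = Vector.foldr _·ᵢ_ 1ᵢ

  _^ᵢ_ : Ideal → ℕ → Ideal
  I ^ᵢ zero  = 1ᵢ
  I ^ᵢ suc n = I ·ᵢ I ^ᵢ n

  record IsPrimeIdeal (P : Ideal) : Set (c ⊔ ℓ) where
    field
      proper : ¬ (P ≐ᵢ 1ᵢ)
      prime  : ∀ {x y} → x * y ∈ ⟦ P ⟧ → x ∈ ⟦ P ⟧ ⊎ y ∈ ⟦ P ⟧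

  record IsMaximalIdeal (M : Ideal) : Set (lsuc (c ⊔ ℓ)) where
    field
      proper  : ¬ (M ≐ᵢ 1ᵢ)
      maximal : ∀ I → ⟦ M ⟧ ⊂ ⟦ I ⟧ → I ≐ᵢ 1ᵢ

  record IsIntegralDomain : Set (c ⊔ ℓ) where
    field
      1≉0            : ¬ (1# ≈ 0#)
      noZeroDivisors : ∀ {x y} → x * y ≈ 0# → x ≈ 0# ⊎ y ≈ 0#

  IsFinitelyGenerated : Ideal → Set (c ⊔ ℓ)
  IsFinitelyGenerated I = ∃[ n ] Σ (Vector Carrier n) λ g →
    (∀ j → g j ∈ ⟦ I ⟧) ×
    (∀ {x} → x ∈ ⟦ I ⟧ → Σ (Vector Carrier n) λ a → x ≈ sum (λ j → a j * g j))

  -- Integrality of the fraction a / b, i.e. a root in the fraction field of a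
  -- monic polynomial tⁿ + Σ_{j<n} cⱼ tʲ, multiplied through by bⁿ.
  IsIntegralFraction : Carrier → Carrier → Set (c ⊔ ℓ)
  IsIntegralFraction a b = ∃[ n ] Σ (Vector Carrier n) λ cs →
    a ^ n + sum (λ j → cs j * a ^ toℕ j * b ^ (n ∸ toℕ j)) ≈ 0#

  record IsDedekindDomain : Set (lsuc (c ⊔ ℓ)) where
    field
      isIntegralDomain : IsIntegralDomain
      noetherian       : ∀ I → IsFinitelyGenerated I
      integrallyClosed : ∀ a b → ¬ (b ≈ 0#) → IsIntegralFraction a b → ∃[ q ] a ≈ q * b
      primesMaximal    : ∀ P → IsPrimeIdeal P → ¬ (P ≐ᵢ 0ᵢ) → IsMaximalIdeal P

  Quotient : Ideal → CommutativeRing c (c ⊔ ℓ)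
  Quotient I = record
    { Carrier = Carrier
    ; _≈_     = _∼_
    ; _+_     = _+_
    ; _*_     = _*_
    ; -_      = -_
    ; 0#      = 0#
    ; 1#      = 1#
    ; isCommutativeRing = record
      { isRing = record
        { +-isAbelianGroup = record
          { isGroup = record
            { isMonoid = record
              { isSemigroup = record
                { isMagma = record
                  { isEquivalence = record
                    { refl = ≈⇒∼ refl ; sym = ∼-sym ; trans = ∼-trans }
                  ; ∙-cong = ∼-+-cong
                  }
                ; assoc = λ x y z → ≈⇒∼ (+-assoc x y z)
                }
              ; identity = (λ x → ≈⇒∼ (+-identityˡ x)) , (λ x → ≈⇒∼ (+-identityʳ x))
              }
            ; inverse = (λ x → ≈⇒∼ (-‿inverseˡ x)) , (λ x → ≈⇒∼ (-‿inverseʳ x))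
            ; ⁻¹-cong = ∼-neg-cong
            }
          ; comm = λ x y → ≈⇒∼ (+-comm x y)
          }
        ; *-cong     = ∼-*-cong
        ; *-assoc    = λ x y z → ≈⇒∼ (*-assoc x y z)
        ; *-identity = (λ x → ≈⇒∼ (*-identityˡ x)) , (λ x → ≈⇒∼ (*-identityʳ x))
        ; distrib    = (λ x y z → ≈⇒∼ (distribˡ x y z)) , (λ x y z → ≈⇒∼ (distribʳ x y z))
        }
      ; *-comm = λ x y → ≈⇒∼ (*-comm x y)
      }
    }
    where
      open Ideal I
      open RingProperties ring
      open CommutativeSemigroupProperties +-commutativeSemigroup using (interchange)
      open import Relation.Binary.Reasoning.Setoid setoid

      _∼_ : Carrier → Carrier → Set (c ⊔ ℓ)
      x ∼ y = x - y ∈ members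

      ≈⇒∼ : ∀ {x y} → x ≈ y → x ∼ y
      ≈⇒∼ x≈y = respects (sym (trans (+-congʳ x≈y) (-‿inverseʳ _))) 0∈

      neg-closed : ∀ {x} → x ∈ members → - x ∈ members
      neg-closed {x} p = respects (-1*x≈-x x) (*-closed (- 1#) p)

      ∼-sym : ∀ {x y} → x ∼ y → y ∼ x
      ∼-sym {x} {y} p = respects (⁻¹-anti-homo-// x y) (neg-closed p)

      ∼-trans : ∀ {x y z} → x ∼ y → y ∼ z → x ∼ z
      ∼-trans {x} {y} {z} p q = respects eq (+-closed p q)
        where
          eq : (x - y) + (y - z) ≈ x - z
          eq = begin
            (x - y) + (y - z)    ≈⟨ +-assoc x (- y) (y - z) ⟩
            x + (- y + (y - z))  ≈⟨ +-congˡ (+-assoc (- y) y (- z)) ⟨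
            x + ((- y + y) - z)  ≈⟨ +-congˡ (+-congʳ (-‿inverseˡ y)) ⟩
            x + (0# - z)         ≈⟨ +-congˡ (+-identityˡ (- z)) ⟩
            x - z                ∎

      ∼-+-cong : ∀ {x y u v} → x ∼ y → u ∼ v → (x + u) ∼ (y + v)
      ∼-+-cong {x} {y} {u} {v} p q = respects eq (+-closed p q)
        where
          eq : (x - y) + (u - v) ≈ (x + u) - (y + v)
          eq = trans (interchange x (- y) u (- v)) (+-congˡ (-‿+-comm y v))

      ∼-neg-cong : ∀ {x y} → x ∼ y → (- x) ∼ (- y)
      ∼-neg-cong {x} {y} p = respects (sym (-‿+-comm x (- y))) (neg-closed p)

      ∼-*-cong : ∀ {x y u v} → x ∼ y → u ∼ v → (x * u) ∼ (y * v)
      ∼-*-cong {x} {y} {u} {v} p q =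
        ∼-trans (respects (trans (*-comm u (x - y)) ([y-z]x≈yx-zx u x y)) (*-closed u p))
                (respects (x[y-z]≈xy-xz y u v) (*-closed y q))

  -- Enumerating Quotient I decides membership in I.  Applied to the ideals
  -- { x | x ∈ J or A }, for a proposition A, this yields excluded middle as soon
  -- as there is a nonzero proper ideal J, so no separate classical axiom is needed.
  FiniteNormProperty : Set (lsuc (c ⊔ ℓ))
  FiniteNormProperty = ∀ I → ¬ (I ≐ᵢ 0ᵢ) →
    ∃[ n ] HasCardinality (CommutativeRing.setoid (Quotient I)) n

  -- The elements of A up to congruence modulo B; this is A / B when B ⊆ A.
  Subquotient : Ideal → Ideal → Setoid (c ⊔ ℓ) (c ⊔ ℓ)
  Subquotient A B = On.setoid {B = Σ Carrier (_∈ ⟦ A ⟧)}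
    (CommutativeRing.setoid (Quotient B)) proj₁

  record IsCompleteResidueSystem (I : Ideal) (𝒟 : Pred Carrier (c ⊔ ℓ)) : Set (c ⊔ ℓ) where
    field
      represents : ∀ x → ∃[ d ] d ∈ 𝒟 × x - d ∈ ⟦ I ⟧
      unique     : ∀ {d d′} → d ∈ 𝒟 → d′ ∈ 𝒟 → d - d′ ∈ ⟦ I ⟧ → d ≈ d′

  -- Terms (coefficient, exponent vector); several lists denote the same
  -- polynomial, which is harmless as only values of polynomials are used.
  MvPolynomial : ℕ → Set c
  MvPolynomial r = List (Carrier × Vec ℕ r)

  eval : ∀ {r} → MvPolynomial r → Vector Carrier r → Carrier
  eval []            x = 0#
  eval ((a , k) ∷ F) x = a * ∏ (λ i → x i ^ lookup k i) + eval F x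

  -- V = w_P(a).  The powers of P need not be distinct (they stabilise when R is
  -- finite), so "highest" refers to the smallest power of P, as an ideal, that
  -- contains a.
  IsW : Ideal → Carrier → Ideal → Set (c ⊔ ℓ)
  IsW P a V =
      (a ≈ 0# × V ≐ᵢ 0ᵢ)
    ⊎ (¬ (a ≈ 0#) ×
        ∃[ m ] V ≐ᵢ P ^ᵢ m × a ∈ ⟦ P ^ᵢ m ⟧ ×
               (∀ m′ → a ∈ ⟦ P ^ᵢ m′ ⟧ → P ^ᵢ m ⊆ᵢ P ^ᵢ m′))

  differences : (ℕ → Carrier) → ℕ → Carrier → Carrier
  differences b k x = ∏ {k} (λ j → x - b (toℕ j))

  -- "As large as possible" is with respect to inclusion of ideals.
  record IsOrdering (P : Ideal) (X : Pred Carrier (c ⊔ ℓ)) (b : ℕ → Carrier) :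
                    Set (lsuc (c ⊔ ℓ)) where
    field
      inside  : ∀ k → b k ∈ X
      largest : ∀ k → 1 ℕ.≤ k → ∀ {x} → x ∈ X → ∀ {V W} →
                IsW P (differences b k x) V → IsW P (differences b k (b k)) W → V ⊆ᵢ W

  -- V is a value of v_k(X, P), computed from some P-ordering of X.
  IsV : (P : Ideal) (X : Pred Carrier (c ⊔ ℓ)) → ℕ → Ideal → Set (lsuc (c ⊔ ℓ))
  IsV P X zero      V = Lift (lsuc (c ⊔ ℓ)) (V ≐ᵢ 1ᵢ)
  IsV P X k@(suc _) V = ∃[ b ] IsOrdering P X b × IsW P (differences b k (b k)) V

module _ {c ℓ : Level} (D : CommutativeRing c ℓ) where

  open CommutativeRing D using (Carrier; _≈_; _-_; 0#)
  open Ideals D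

  reduce : (K : Ideal) → Ideal → Ideals.Ideal (Quotient K)
  reduce K I = record
    { members  = λ x → ∃[ y ] y ∈ ⟦ I ⟧ × x R.≈ y
    ; respects = λ { e (y , p , q) → y , p , R.trans (R.sym e) q }
    ; 0∈       = 0# , I.0∈ , R.refl
    ; +-closed = λ { (y , p , q) (y′ , p′ , q′) →
        y R.+ y′ , I.+-closed p p′ , R.+-cong q q′ }
    ; *-closed = λ { a (y , p , q) → a R.* y , I.*-closed a p , R.*-congˡ q }
    } where
      module I = Ideal I
      module R = CommutativeRing (Quotient K)

  record Setting : Set (lsuc (c ⊔ ℓ)) where
    field
      r         : ℕ
      1≤r       : 1 ℕ.≤ r
      I         : Vector Ideal r
      J         : Ideal
      I≠0       : ∀ i → ¬ (I i ≐ᵢ 0ᵢ)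
      I≠D       : ∀ i → ¬ (I i ≐ᵢ 1ᵢ)
      J≠0       : ¬ (J ≐ᵢ 0ᵢ)
      J≠D       : ¬ (J ≐ᵢ 1ᵢ)
      𝒟         : Fin r → Pred Carrier (c ⊔ ℓ)
      𝒟-residue : ∀ i → IsCompleteResidueSystem (I i) (𝒟 i)
      0∈𝒟       : ∀ i → 0# ∈ 𝒟 i

    K : Ideal
    K = ⋂ᵢ I ∩ᵢ J

    field
      n           : ℕ
      P           : Vector Ideal n
      e           : Vector ℕ n
      P-prime     : ∀ l → IsPrimeIdeal (P l)
      P≠0         : ∀ l → ¬ (P l ≐ᵢ 0ᵢ)
      P-distinct  : ∀ {l m} → P l ≐ᵢ P m → l ≡ m
      1≤e         : ∀ l → 1 ℕ.≤ e l
      K-factorise : K ≐ᵢ ∏ᵢ (λ l → P l ^ᵢ e l)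

module _ {c ℓ : Level} {D : CommutativeRing c ℓ} (S : Setting D) where

  open Setting S
  private
    module D = CommutativeRing D
    module DI = Ideals D

    R : CommutativeRing c (c ⊔ ℓ)
    R = DI.Quotient K

    module R = CommutativeRing R
    module RI = Ideals R

    ι : DI.Ideal → RI.Ideal
    ι = reduce D K

  X : Fin r → Pred R.Carrier (c ⊔ ℓ)
  X i x = ∃[ d ] d ∈ 𝒟 i × x R.≈ d

  -- v i k l stands for v_k(X_i, P̄_l).  The P̄_l are indexed by the prime divisors
  -- of K, so P̄_1 is the zero ideal in the case where K itself is prime.
  VFamily : Set (lsuc (c ⊔ ℓ))
  VFamily = Fin r → ℕ → Fin n → RI.Ideal

  IsVFamily : VFamily → Set (lsuc (c ⊔ ℓ))
  IsVFamily v = ∀ i k l → RI.IsV (ι (P l)) (X i) k (v i k l)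

  module _ (v : VFamily) where

    vₖ : Fin r → ℕ → RI.Ideal
    vₖ i k = RI.∏ᵢ (v i k)

    Isμ : Fin r → ℕ → Set (c ⊔ ℓ)
    Isμ i m =
        (1 ℕ.≤ m × vₖ i m RI.⊆ᵢ ι J ×
          (∀ k → 1 ℕ.≤ k → k ℕ.< m → ¬ (vₖ i k RI.⊆ᵢ ι J)))
      ⊎ ((∀ k → 1 ℕ.≤ k → ¬ (vₖ i k RI.⊆ᵢ ι J)) ×
          HasCardinality (CommutativeRing.setoid (DI.Quotient (I i))) m)

    -- (v_{k₁}(X₁) ⋯ v_{kᵣ}(Xᵣ) + J̄) / J̄
    Factor : Vec ℕ r → Setoid (c ⊔ ℓ) (c ⊔ ℓ)
    Factor k = RI.Subquotient (RI.∏ᵢ (λ i → vₖ i (lookup k i)) RI.+ᵢ ι J) (ι J)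

    IsN : ℕ → Set (c ⊔ ℓ)
    IsN N = Σ (Vec ℕ r) λ μ → (∀ i → Isμ i (lookup μ i)) ×
      Σ (Vec ℕ r → ℕ) λ card → (∀ k → HasCardinality (Factor k) (card k)) ×
        N ≡ product (List.map card (box μ))

  Domain : Setoid (c ⊔ ℓ) ℓ
  Domain = On.setoid {B = Σ (Vector D.Carrier r) λ b → ∀ i → b i ∈ 𝒟 i}
    (VectorEquality.≋-setoid D.setoid r) proj₁

  Codomain : Setoid c (c ⊔ ℓ)
  Codomain = CommutativeRing.setoid (DI.Quotient J)

  IsPolynomialFunction : Func Domain Codomain → Set (c ⊔ ℓ)
  IsPolynomialFunction f = Σ (DI.MvPolynomial r) λ F →
    ∀ b → DI.eval F (proj₁ b) D.- (f ⟨$⟩ b) ∈ DI.⟦ J ⟧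

  PolynomialFunctions : Setoid (c ⊔ ℓ) (c ⊔ ℓ)
  PolynomialFunctions = On.setoid {B = Σ (Func Domain Codomain) IsPolynomialFunction}
    (FuncEquality.setoid Domain Codomain) proj₁

{-# OPTIONS --safe #-}

-- Let A_l = P_l^{e_l} and π_k(b) = ∏_{j<k} (b_k - b_j) for a sequence b.  Since D/P_l^e
-- is a finite local principal ideal ring, a P_l-ordering b of X_i satisfies
-- ∏_{j<k} (x - b_j) ∈ (π_k(b)) + A_l for all x ∈ X_i.  By the Chinese remainder theorem
-- such orderings, one for each l, are glued to a single sequence b⁽ⁱ⁾ in D, and then
-- v_k(X_i) is generated by π_k(b⁽ⁱ⁾).  Modulo J, every polynomial agrees on the given
-- residues with a combination Σ c_k ∏_i ∏_{j<k_i} (x_i - b⁽ⁱ⁾_j) over the k in the box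
-- k_i < μ(I_i, J), because ∏_{j<μ} (x - b⁽ⁱ⁾_j) vanishes there.  By triangularity the
-- combination vanishes exactly if c_k ∏_i π_{k_i}(b⁽ⁱ⁾) ∈ J for all k, so that polynomial
-- functions correspond to families of elements of ((∏_i π_{k_i}(b⁽ⁱ⁾)) + J) / J.

module Submission where

open import Defs
open import Algebra.Bundles using (CommutativeRing; RawRing; Semiring)
import Algebra.Definitions.RawSemiring as RawSemiringDefinitions
open import Data.Empty using (⊥; ⊥-elim)
open import Data.Fin.Base as Fin using (Fin; zero; suc; toℕ; combine; remQuot)
import Data.Fin.Properties as Fin
open import Data.Integer.Base as ℤ using (ℤ; 0ℤ; 1ℤ; -1ℤ)
import Data.Integer.Properties as ℤ
open import Data.List.Base as List using (List; []; _∷_; _++_; allFin; upTo; cartesianProductWith)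
open import Data.List.Extrema.Nat using (argmin; f[argmin]≤f[xs])
open import Data.List.Membership.Propositional using () renaming (_∈_ to _∈ₗ_)
open import Data.List.Membership.Propositional.Properties
  using (∈-allFin; ∈-cartesianProductWith⁻; ∈-upTo⁻)
open import Data.List.Properties using (upTo-∷ʳ)
open import Data.List.Relation.Unary.All as All using (All)
open import Data.List.Relation.Unary.AllPairs using ([]; _∷_)
open import Data.List.Relation.Unary.Any using (here; there)
open import Data.List.Relation.Unary.Unique.Propositional using (Unique)
open import Data.List.Relation.Unary.Unique.Propositional.Properties using (cartesianProductWith⁺; upTo⁺)
open import Data.Maybe.Base as Maybe using (Maybe)
open import Data.Nat.Base as ℕ using (ℕ; zero; suc; z≤n; s≤s; _∸_)
open import Data.Nat.Induction using (<-rec)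
open import Data.Nat.ListAction using (product)
import Data.Nat.Properties as ℕ
open import Data.Product.Base using (Σ; ∃-syntax; _×_; _,_; proj₁; proj₂)
open import Data.Sum.Base as Sum using (_⊎_; inj₁; inj₂)
open import Data.Unit.Polymorphic.Base using (tt)
open import Data.Vec.Base as Vec using (Vec; lookup)
open import Data.Vec.Functional using (Vector; tail) renaming (_∷_ to _∷ᶠ_)
open import Data.Vec.Properties using (≡-dec; ∷-injective; lookup-replicate; lookup-zipWith; lookup∘tabulate)
open import Function.Base using (_∘_; id; case_of_)
open import Function.Bundles using (Bijection; Func; Inverse)
import Function.Construct.Composition as Composition
import Function.Construct.Symmetry as Symmetry
open import Function.Properties.Bijection using (Bijection⇒Inverse)
open import Level using (Level; _⊔_; Lift; lift; lower) renaming (suc to lsuc)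
open import Relation.Binary.Bundles using (Setoid)
open import Relation.Binary.Definitions using (Decidable; DecidableEquality; tri<; tri≈; tri>)
open import Relation.Binary.PropositionalEquality.Core as ≡ using (_≡_; _≢_)
import Relation.Binary.PropositionalEquality.Properties as ≡ₚ
open import Relation.Nullary.Decidable using (Dec; yes; no; dec⇒maybe; decidable-stable)
open import Relation.Nullary.Negation.Core using (¬_; contradiction)
open import Relation.Unary using (Pred; _∈_; _∉_)

-- The convention w(0) = 0 is what complicates the identity v_k(X_i) = (π_k). An element of A_l
-- outside K has w equal to the stable power of P̄_l, whereas elements of K have w = 0, so a
-- P̄_l-ordering depends on K and not only on A_l. The inclusion v_k(X_i) ⊆ (π_k) can still be
-- checked modulo each A_l. The converse splits: if every factor v_k(X_i, P̄_l) is a power of its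
-- prime, the factors are comaximal and contain the A_l; if some factor is 0, the monic polynomial
-- of that ordering vanishes on X_i modulo all of K, and a minimality property of π_k puts it into
-- every A_l. This minimality holds because a monic Newton polynomial keeps leading coefficient 1 in
-- any other Newton basis, so that triangularity speaks of the pivot itself. Principality at P comes
-- from a fraction b/a outside D with (b/a)P ⊆ D. It is built from a socle element of D/(a)
-- localised at P; integral closure and finiteness of D/(a) then prevent (b/a)P ⊆ P.

-- Ring solver with integer coefficients.

module IntegerSolver {c ℓ : Level} (R : CommutativeRing c ℓ) where
  open CommutativeRing R
  open import Algebra.Properties.Ring ring
  open import Algebra.Properties.Semiring.Mult.TCOptimised semiring renaming (_×_ to _·_)
  open import Algebra.Solver.Ring.AlmostCommutativeRing
  open import Data.Integer.Base using (+_; -[1+_])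
  open import Relation.Binary.Reasoning.Setoid setoid

  -- Integer coefficients have decidable equality, which the carrier need not have. The optimised
  -- multiple makes the images of 0 and 1 compute to `0#` and `1#`, so solver equations match goals
  -- as written.
  ⟦_⟧ℤ : ℤ → Carrier
  ⟦ + n      ⟧ℤ = n · 1#
  ⟦ -[1+ n ] ⟧ℤ = - (suc n · 1#)

  neg-homo : ∀ i → ⟦ ℤ.- i ⟧ℤ ≈ - ⟦ i ⟧ℤ
  neg-homo (+ zero)  = sym -0#≈0#
  neg-homo (+ suc n) = refl
  neg-homo -[1+ n ]  = sym (-‿involutive _)

  ⊖-homo : ∀ m n → ⟦ m ℤ.⊖ n ⟧ℤ ≈ m · 1# - n · 1#
  ⊖-homo m zero = sym (trans (+-congˡ -0#≈0#) (+-identityʳ _))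
  ⊖-homo zero (suc n) = sym (+-identityˡ _)
  ⊖-homo (suc m) (suc n) = begin
    ⟦ suc m ℤ.⊖ suc n ⟧ℤ                ≈⟨ reflexive (≡.cong ⟦_⟧ℤ (ℤ.[1+m]⊖[1+n]≡m⊖n m n)) ⟩
    ⟦ m ℤ.⊖ n ⟧ℤ                        ≈⟨ ⊖-homo m n ⟩
    m · 1# - n · 1#                      ≈⟨ +-congʳ (+-identityˡ _) ⟨
    (0# + m · 1#) - n · 1#               ≈⟨ +-congʳ (+-congʳ (-‿inverseʳ 1#)) ⟨
    ((1# - 1#) + m · 1#) - n · 1#        ≈⟨ +-congʳ (+-assoc _ _ _) ⟩
    (1# + (- 1# + m · 1#)) - n · 1#      ≈⟨ +-congʳ (+-congˡ (+-comm _ _)) ⟩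
    (1# + (m · 1# - 1#)) - n · 1#        ≈⟨ +-congʳ (+-assoc _ _ _) ⟨
    ((1# + m · 1#) - 1#) - n · 1#        ≈⟨ +-assoc _ _ _ ⟩
    (1# + m · 1#) + (- 1# - n · 1#)      ≈⟨ +-congˡ (-‿+-comm _ _) ⟩
    (1# + m · 1#) - (1# + n · 1#)        ≈⟨ +-cong (1+× m 1#) (-‿cong (1+× n 1#)) ⟨
    suc m · 1# - suc n · 1#              ∎

  +-homo : ∀ i j → ⟦ i ℤ.+ j ⟧ℤ ≈ ⟦ i ⟧ℤ + ⟦ j ⟧ℤ
  +-homo (+ m)    (+ n)    = ×-homo-+ 1# m n
  +-homo (+ m)    -[1+ n ] = ⊖-homo m (suc n)
  +-homo -[1+ m ] (+ n)    = trans (⊖-homo n (suc m)) (+-comm _ _)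
  +-homo -[1+ m ] -[1+ n ] = begin
    - (suc (suc (m ℕ.+ n)) · 1#)        ≈⟨ -‿cong (reflexive (≡.cong (_· 1#) (≡.cong suc (ℕ.+-suc m n)))) ⟨
    - ((suc m ℕ.+ suc n) · 1#)          ≈⟨ -‿cong (×-homo-+ 1# (suc m) (suc n)) ⟩
    - (suc m · 1# + suc n · 1#)         ≈⟨ -‿+-comm _ _ ⟨
    - (suc m · 1#) - (suc n · 1#)       ∎

  *-homo : ∀ i j → ⟦ i ℤ.* j ⟧ℤ ≈ ⟦ i ⟧ℤ * ⟦ j ⟧ℤ
  *-homo (+ m)     (+ n)     = trans (reflexive (≡.cong ⟦_⟧ℤ (≡.sym (ℤ.pos-* m n)))) (×1-homo-* m n)
  *-homo (+ zero)  -[1+ n ]  = sym (zeroˡ _)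
  *-homo (+ suc m) -[1+ n ]  = trans (-‿cong (×1-homo-* (suc m) (suc n))) (-‿distribʳ-* _ _)
  *-homo -[1+ m ]  (+ zero)  = trans (reflexive (≡.cong ⟦_⟧ℤ (ℤ.*-zeroʳ -[1+ m ]))) (sym (zeroʳ _))
  *-homo -[1+ m ]  (+ suc n) = trans (-‿cong (×1-homo-* (suc m) (suc n))) (-‿distribˡ-* _ _)
  *-homo -[1+ m ]  -[1+ n ]  = trans (×1-homo-* (suc m) (suc n))
    (sym (trans (sym (-‿distribˡ-* _ _)) (trans (-‿cong (sym (-‿distribʳ-* _ _))) (-‿involutive _))))

  ℤ-rawRing : RawRing _ _
  ℤ-rawRing = record
    { Carrier = ℤ ; _≈_ = _≡_ ; _+_ = ℤ._+_ ; _*_ = ℤ._*_ ; -_ = ℤ.-_ ; 0# = ℤ.0ℤ ; 1# = ℤ.1ℤ }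

  homomorphism : ℤ-rawRing -Raw-AlmostCommutative⟶ fromCommutativeRing R
  homomorphism = record
    { ⟦_⟧ = ⟦_⟧ℤ ; +-homo = +-homo ; *-homo = *-homo ; -‿homo = neg-homo
    ; 0-homo = refl ; 1-homo = refl }

  open import Algebra.Solver.Ring ℤ-rawRing (fromCommutativeRing R) homomorphism
    (λ i j → Maybe.map (λ i≡j → reflexive (≡.cong ⟦_⟧ℤ i≡j)) (dec⇒maybe (i ℤ.≟ j))) public

-- Ideal arithmetic, comaximality and the Chinese remainder theorem.

module IdealProperties {c ℓ : Level} (R : CommutativeRing c ℓ) where
  open CommutativeRing R hiding (zero)
  open Ideals R
  open RawSemiringDefinitions (Semiring.rawSemiring semiring) using () renaming (product to ∏)
  open IntegerSolver R using (solve; con; _:+_; _:*_; _:-_; :-_; _:=_)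
  private variable
    I I′ J J′ : Ideal
    x y : Carrier

  infix 4 _≈[_]_
  _≈[_]_ : Carrier → Ideal → Carrier → Set (c ⊔ ℓ)
  x ≈[ I ] y = x - y ∈ ⟦ I ⟧

  module Mod (I : Ideal) = CommutativeRing (Quotient I)

  ≈⇒≈[] : ∀ I → x ≈ y → x ≈[ I ] y
  ≈⇒≈[] I x≈y = Ideal.respects I (sym (trans (+-congʳ x≈y) (-‿inverseʳ _))) (Ideal.0∈ I)

  ∈-resp : ∀ I → x ≈ y → y ∈ ⟦ I ⟧ → x ∈ ⟦ I ⟧
  ∈-resp I x≈y = Ideal.respects I (sym x≈y)

  ∈-neg : ∀ I → x ∈ ⟦ I ⟧ → - x ∈ ⟦ I ⟧
  ∈-neg {x} I p = ∈-resp I (solve 1 (λ x → :- x := con -1ℤ :* x) refl x) (Ideal.*-closed I _ p)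

  ∈-sub : ∀ I → x ∈ ⟦ I ⟧ → y ∈ ⟦ I ⟧ → x - y ∈ ⟦ I ⟧
  ∈-sub I p q = Ideal.+-closed I p (∈-neg I q)

  ∈-*ʳ : ∀ I → x ∈ ⟦ I ⟧ → x * y ∈ ⟦ I ⟧
  ∈-*ʳ I p = ∈-resp I (*-comm _ _) (Ideal.*-closed I _ p)

  ∈-resp-≈[] : ∀ I → x ≈[ I ] y → y ∈ ⟦ I ⟧ → x ∈ ⟦ I ⟧
  ∈-resp-≈[] {x} {y} I p q = ∈-resp I
    (solve 2 (λ x y → x := (x :- y) :+ y) refl x y) (Ideal.+-closed I p q)

  ∈⇒≈[]0 : ∀ I → x ∈ ⟦ I ⟧ → x ≈[ I ] 0#
  ∈⇒≈[]0 {x} I = ∈-resp I (solve 1 (λ x → x :- con 0ℤ := x) refl x)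

  ≈[]0⇒∈ : ∀ I → x ≈[ I ] 0# → x ∈ ⟦ I ⟧
  ≈[]0⇒∈ {x} I = ∈-resp I (solve 1 (λ x → x := x :- con 0ℤ) refl x)

  1∈⇒≐1 : ∀ I → 1# ∈ ⟦ I ⟧ → I ≐ᵢ 1ᵢ
  1∈⇒≐1 I 1∈I = (λ _ → tt) , λ {x} _ → ∈-resp I (sym (*-identityʳ x)) (Ideal.*-closed I x 1∈I)

  ⟨_⟩ : Carrier → Ideal
  ⟨ a ⟩ = record
    { members  = λ x → Lift c (∃[ t ] x ≈ t * a)
    ; respects = λ { e (lift (t , p)) → lift (t , trans (sym e) p) }
    ; 0∈       = lift (0# , sym (zeroˡ a))
    ; +-closed = λ { (lift (t , p)) (lift (u , q)) → lift (t + u , trans (+-cong p q) (sym (distribʳ a t u))) }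
    ; *-closed = λ { d (lift (t , p)) → lift (d * t , trans (*-congˡ p) (sym (*-assoc d t a))) }
    }

  *∈⟨⟩ : ∀ t a → t * a ∈ ⟦ ⟨ a ⟩ ⟧
  *∈⟨⟩ t a = lift (t , refl)

  ∈⟨⟩ : ∀ a → a ∈ ⟦ ⟨ a ⟩ ⟧
  ∈⟨⟩ a = lift (1# , sym (*-identityˡ a))

  ⟨⟩-least : ∀ {a} L → a ∈ ⟦ L ⟧ → ⟨ a ⟩ ⊆ᵢ L
  ⟨⟩-least L p (lift (t , e)) = ∈-resp L e (Ideal.*-closed L t p)

  +ᵢ-inˡ : ∀ I J → I ⊆ᵢ I +ᵢ J
  +ᵢ-inˡ I J p = _ , 0# , p , Ideal.0∈ J , sym (+-identityʳ _)

  +ᵢ-inʳ : ∀ I J → J ⊆ᵢ I +ᵢ J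
  +ᵢ-inʳ I J p = 0# , _ , Ideal.0∈ I , p , sym (+-identityˡ _)

  +ᵢ-least : ∀ L → I ⊆ᵢ L → J ⊆ᵢ L → I +ᵢ J ⊆ᵢ L
  +ᵢ-least L f g (a , b , p , q , e) = ∈-resp L e (Ideal.+-closed L (f p) (g q))

  +ᵢ-mono : I ⊆ᵢ I′ → J ⊆ᵢ J′ → I +ᵢ J ⊆ᵢ I′ +ᵢ J′
  +ᵢ-mono f g (a , b , p , q , e) = a , b , f p , g q , e

  ·ᵢ-in : x ∈ ⟦ I ⟧ → y ∈ ⟦ J ⟧ → x * y ∈ ⟦ I ·ᵢ J ⟧
  ·ᵢ-in p q = add p q (empty refl) (sym (+-identityʳ _))

  ·ᵢ-least : ∀ L → (∀ {x y} → x ∈ ⟦ I ⟧ → y ∈ ⟦ J ⟧ → x * y ∈ ⟦ L ⟧) → I ·ᵢ J ⊆ᵢ L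
  ·ᵢ-least L f (empty e)     = ∈-resp L e (Ideal.0∈ L)
  ·ᵢ-least L f (add p q m e) = ∈-resp L e (Ideal.+-closed L (f p q) (·ᵢ-least L f m))

  ·ᵢ-mono : I ⊆ᵢ I′ → J ⊆ᵢ J′ → I ·ᵢ J ⊆ᵢ I′ ·ᵢ J′
  ·ᵢ-mono {I} {I′} {J} {J′} f g =
    ·ᵢ-least (I′ ·ᵢ J′) (λ p q → ·ᵢ-in {I = I′} {J = J′} (f p) (g q))

  ·ᵢ⊆ˡ : ∀ I J → I ·ᵢ J ⊆ᵢ I
  ·ᵢ⊆ˡ I J = ·ᵢ-least I (λ p q → ∈-*ʳ I p)

  ·ᵢ⊆ʳ : ∀ I J → I ·ᵢ J ⊆ᵢ J
  ·ᵢ⊆ʳ I J = ·ᵢ-least J (λ p q → Ideal.*-closed J _ q)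

  ^ᵢ-antitone : ∀ I {m n} → m ℕ.≤ n → I ^ᵢ n ⊆ᵢ I ^ᵢ m
  ^ᵢ-antitone I z≤n       _ = tt
  ^ᵢ-antitone I (s≤s m≤n) = ·ᵢ-mono {I = I} {I′ = I} id (^ᵢ-antitone I m≤n)

  ∏ᵢ⊆ : ∀ {n} (A : Vector Ideal n) l → ∏ᵢ A ⊆ᵢ A l
  ∏ᵢ⊆ A zero    = ·ᵢ⊆ˡ (A zero) (∏ᵢ (tail A))
  ∏ᵢ⊆ A (suc l) = ∏ᵢ⊆ (tail A) l ∘ ·ᵢ⊆ʳ (A zero) (∏ᵢ (tail A))

  ∏ᵢ-in : ∀ {n} {A : Vector Ideal n} {a : Vector Carrier n} → (∀ l → a l ∈ ⟦ A l ⟧) → ∏ a ∈ ⟦ ∏ᵢ A ⟧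
  ∏ᵢ-in {zero}      f = tt
  ∏ᵢ-in {suc n} {A} f = ·ᵢ-in {I = A zero} {J = ∏ᵢ (tail A)} (f zero) (∏ᵢ-in (f ∘ suc))

  ∏ᵢ-⊆⟨⟩ : ∀ {n} {A : Vector Ideal n} {a : Vector Carrier n} → (∀ l → A l ⊆ᵢ ⟨ a l ⟩) → ∏ᵢ A ⊆ᵢ ⟨ ∏ a ⟩
  ∏ᵢ-⊆⟨⟩ {zero}          f _ = lift (_ , sym (*-identityʳ _))
  ∏ᵢ-⊆⟨⟩ {suc n} {A} {a} f = ·ᵢ-least ⟨ ∏ a ⟩ λ p q → mul (f zero p) (∏ᵢ-⊆⟨⟩ {a = tail a} (f ∘ suc) q)
    where
      mul : ∀ {x y} → x ∈ ⟦ ⟨ a zero ⟩ ⟧ → y ∈ ⟦ ⟨ ∏ (tail a) ⟩ ⟧ → x * y ∈ ⟦ ⟨ ∏ a ⟩ ⟧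
      mul (lift (t , e)) (lift (u , e′)) = lift (t * u , trans (*-cong e e′)
        (solve 4 (λ t a u b → (t :* a) :* (u :* b) := (t :* u) :* (a :* b)) refl t (a zero) u (∏ (tail a))))

  *∈-⟨⟩+ : ∀ Z u a {x} → u * a ∈ ⟦ Z ⟧ → x ∈ ⟦ ⟨ a ⟩ +ᵢ Z ⟧ → u * x ∈ ⟦ Z ⟧
  *∈-⟨⟩+ Z u a ua∈Z (_ , z , lift (t , e) , z∈Z , e′) = ∈-resp Z
    (trans (*-congˡ (trans e′ (+-congʳ e)))
      (solve 4 (λ u t a z → u :* (t :* a :+ z) := t :* (u :* a) :+ u :* z) refl u t a z))
    (Ideal.+-closed Z (Ideal.*-closed Z t ua∈Z) (Ideal.*-closed Z u z∈Z))

  ∏∈⟨∏⟩+ : ∀ Z {n} (x a : Vector Carrier n) → (∀ i → x i ∈ ⟦ ⟨ a i ⟩ +ᵢ Z ⟧) → ∏ x ∈ ⟦ ⟨ ∏ a ⟩ +ᵢ Z ⟧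
  ∏∈⟨∏⟩+ Z {zero}  x a f = +ᵢ-inˡ ⟨ 1# ⟩ Z (∈⟨⟩ 1#)
  ∏∈⟨∏⟩+ Z {suc n} x a f = mul (f zero) (∏∈⟨∏⟩+ Z (tail x) (tail a) (f ∘ suc))
    where
      mul : ∀ {x y a b} → x ∈ ⟦ ⟨ a ⟩ +ᵢ Z ⟧ → y ∈ ⟦ ⟨ b ⟩ +ᵢ Z ⟧ → x * y ∈ ⟦ ⟨ a * b ⟩ +ᵢ Z ⟧
      mul {x} {y} {a} {b} (_ , z , lift (t , e) , z∈ , p) (_ , w , lift (u , e′) , w∈ , q) =
        (t * u) * (a * b) , (t * a) * w + z * y , *∈⟨⟩ (t * u) (a * b) ,
        Ideal.+-closed Z (Ideal.*-closed Z _ w∈) (∈-*ʳ Z z∈) ,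
        trans (trans (*-congʳ (trans p (+-congʳ e))) (distribʳ y (t * a) z))
          (trans (+-congʳ (trans (*-congˡ (trans q (+-congʳ e′))) (distribˡ (t * a) (u * b) w)))
            (solve 6 (λ t a u b w v → ((t :* a) :* (u :* b) :+ (t :* a) :* w) :+ v :=
              (t :* u) :* (a :* b) :+ ((t :* a) :* w :+ v)) refl t a u b w (z * y)))

  Comaximal : Ideal → Ideal → Set (c ⊔ ℓ)
  Comaximal A B = ∃[ s ] s ∈ ⟦ A ⟧ × 1# - s ∈ ⟦ B ⟧

  comaximal-sym : ∀ A B → Comaximal A B → Comaximal B A
  comaximal-sym A B (s , p , q) = 1# - s , q ,
    ∈-resp A (solve 1 (λ s → con 1ℤ :- (con 1ℤ :- s) := s) refl s) p

  comaximal-1 : ∀ A → Comaximal A 1ᵢ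
  comaximal-1 A = 0# , Ideal.0∈ A , tt

  comaximal-· : ∀ A B C → Comaximal A B → Comaximal A C → Comaximal A (B ·ᵢ C)
  comaximal-· A B C (s , p , q) (t , p′ , q′) =
    s + t - s * t ,
    ∈-sub A (Ideal.+-closed A p p′) (∈-*ʳ A p) ,
    ∈-resp (B ·ᵢ C)
      (solve 2 (λ s t → con 1ℤ :- ((s :+ t) :- s :* t) := (con 1ℤ :- s) :* (con 1ℤ :- t)) refl s t)
      (·ᵢ-in {I = B} {J = C} q q′)

  comaximal-^ : ∀ A B → Comaximal A B → ∀ n → Comaximal A (B ^ᵢ n)
  comaximal-^ A B k zero    = comaximal-1 A
  comaximal-^ A B k (suc n) = comaximal-· A B (B ^ᵢ n) k (comaximal-^ A B k n)

  comaximal-^^ : ∀ A B → Comaximal A B → ∀ m n → Comaximal (A ^ᵢ m) (B ^ᵢ n)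
  comaximal-^^ A B k m n = comaximal-^ (A ^ᵢ m) B (comaximal-sym B (A ^ᵢ m)
    (comaximal-^ B A (comaximal-sym A B k) m)) n

  comaximal-∏ : ∀ A {n} (B : Vector Ideal n) → (∀ l → Comaximal A (B l)) → Comaximal A (∏ᵢ B)
  comaximal-∏ A {zero}  B k = comaximal-1 A
  comaximal-∏ A {suc n} B k = comaximal-· A (B zero) (∏ᵢ (tail B)) (k zero) (comaximal-∏ A (tail B) (k ∘ suc))

  comaximal-mono : I ⊆ᵢ I′ → J ⊆ᵢ J′ → Comaximal I J → Comaximal I′ J′
  comaximal-mono f g (s , p , q) = s , f p , g q

  comaximal⇒∈+ : Comaximal I J → ∀ x → x ∈ ⟦ I +ᵢ J ⟧
  comaximal⇒∈+ {I} {J} (s , p , q) x = s * x , (1# - s) * x , ∈-*ʳ I p , ∈-*ʳ J q ,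
    solve 2 (λ s x → x := s :* x :+ (con 1ℤ :- s) :* x) refl s x

  PairwiseComaximal : ∀ {n} → Vector Ideal n → Set (c ⊔ ℓ)
  PairwiseComaximal A = ∀ {l m} → l ≢ m → Comaximal (A l) (A m)

  private
    head-tail : ∀ {n} (A : Vector Ideal (suc n)) → PairwiseComaximal A → Comaximal (A zero) (∏ᵢ (tail A))
    head-tail A k = comaximal-∏ (A zero) (tail A) (λ l → k (λ ()))

    tail-pairwise : ∀ {n} (A : Vector Ideal (suc n)) → PairwiseComaximal A → PairwiseComaximal (tail A)
    tail-pairwise A k l≢m = k (l≢m ∘ Fin.suc-injective)

  -- Let s ∈ A_0 and 1 - s ∈ B, where B is the product of the other ideals. By induction for
  -- `J +ᵢ B`, x is in J up to an element of B, which s sends into A_0 B ⊆ J; likewise 1 - s sends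
  -- the A_0-part of x into J. Later ideal memberships are checked one A_l at a time through this.
  local-global : ∀ {n} (A : Vector Ideal n) → PairwiseComaximal A → ∀ J → ∏ᵢ A ⊆ᵢ J →
                 ∀ {x} → (∀ l → x ∈ ⟦ J +ᵢ A l ⟧) → x ∈ ⟦ J ⟧
  local-global {zero}  A k J ∏⊆J f = ∏⊆J tt
  local-global {suc n} A k J ∏⊆J {x} f with head-tail A k
  ... | s , s∈A , 1-s∈B = ∈-resp J (solve 2 (λ s x → x := s :* x :+ (con 1ℤ :- s) :* x) refl s x)
        (Ideal.+-closed J (part₁ x∈J+B) (part₂ (f zero)))
    where
      B = ∏ᵢ (tail A)

      x∈J+B : x ∈ ⟦ J +ᵢ B ⟧
      x∈J+B = local-global (tail A) (tail-pairwise A k) (J +ᵢ B) (+ᵢ-inʳ J B)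
        (λ l → +ᵢ-mono {I = J} {I′ = J +ᵢ B} {J = A (suc l)} {J′ = A (suc l)} (+ᵢ-inˡ J B) id (f (suc l)))

      part₁ : x ∈ ⟦ J +ᵢ B ⟧ → s * x ∈ ⟦ J ⟧
      part₁ (a , b , p , q , e) = ∈-resp J (trans (*-congˡ e) (distribˡ s a b))
        (Ideal.+-closed J (Ideal.*-closed J s p) (∏⊆J (·ᵢ-in {I = A zero} {J = B} s∈A q)))

      part₂ : x ∈ ⟦ J +ᵢ A zero ⟧ → (1# - s) * x ∈ ⟦ J ⟧
      part₂ (a , b , p , q , e) = ∈-resp J
        (trans (*-congˡ e) (trans (distribˡ _ a b) (+-congˡ (*-comm _ b))))
        (Ideal.+-closed J (Ideal.*-closed J _ p) (∏⊆J (·ᵢ-in {I = A zero} {J = B} q 1-s∈B)))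

  ∈-∏ᵢ-comaximal : ∀ {n} (A : Vector Ideal n) → PairwiseComaximal A → (∀ l → x ∈ ⟦ A l ⟧) → x ∈ ⟦ ∏ᵢ A ⟧
  ∈-∏ᵢ-comaximal A k f = local-global A k (∏ᵢ A) id (λ l → +ᵢ-inʳ (∏ᵢ A) (A l) (f l))

  chineseRemainder : ∀ {n} (A : Vector Ideal n) → PairwiseComaximal A → (x : Vector Carrier n) →
                     ∃[ z ] (∀ l → z ≈[ A l ] x l)
  chineseRemainder {zero}  A k x = 0# , λ ()
  chineseRemainder {suc n} A k x with head-tail A k | chineseRemainder (tail A) (tail-pairwise A k) (tail x)
  ... | s , s∈A , 1-s∈B | y , y≈x = s * y + (1# - s) * x zero , λ
    { zero → ∈-resp (A zero) (solve 3 (λ s y x → (s :* y :+ (con 1ℤ :- s) :* x) :- x := s :* (y :- x)) refl s y (x zero))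
               (∈-*ʳ (A zero) s∈A)
    ; (suc l) → Mod.trans (A (suc l))
        (∏ᵢ⊆ (tail A) l (∈-resp (∏ᵢ (tail A))
          (solve 3 (λ s y x → (s :* y :+ (con 1ℤ :- s) :* x) :- y := (con 1ℤ :- s) :* (x :- y)) refl s y (x zero))
          (∈-*ʳ (∏ᵢ (tail A)) 1-s∈B)))
        (y≈x l) }

-- Newton polynomials in one variable and sequences adapted to an ideal.

module Newton {c ℓ : Level} (R : CommutativeRing c ℓ) where
  open CommutativeRing R hiding (zero)
  open Ideals R
  open IdealProperties R
  open IntegerSolver R using (solve; con; _:+_; _:*_; _:-_; :-_; _:=_)
  open import Relation.Binary.Reasoning.Setoid setoid

  newton : (ℕ → Carrier) → ℕ → Carrier → Carrier
  newton b zero    x = 1#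
  newton b (suc k) x = newton b k x * (x - b k)

  pivot : (ℕ → Carrier) → ℕ → Carrier
  pivot b k = newton b k (b k)

  expand : (ℕ → Carrier) → (ℕ → Carrier) → ℕ → Carrier → Carrier
  expand b a zero    x = 0#
  expand b a (suc m) x = expand b a m x + a m * newton b m x

  newton-suc : ∀ b k x → newton b (suc k) x ≈ (x - b 0) * newton (b ∘ suc) k x
  newton-suc b zero    x = *-comm 1# _
  newton-suc b (suc k) x = trans (*-congʳ (newton-suc b k x)) (*-assoc _ _ _)

  differences≈newton : ∀ b k x → differences b k x ≈ newton b k x
  differences≈newton b zero    x = refl
  differences≈newton b (suc k) x =
    trans (*-congˡ (differences≈newton (b ∘ suc) k x)) (sym (newton-suc b k x))

  newton-node : ∀ b {j k} → j ℕ.< k → newton b k (b j) ≈ 0#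
  newton-node b {j} {suc k} (s≤s j≤k) with ℕ.m≤n⇒m<n∨m≡n j≤k
  ... | inj₁ j<k    = trans (*-congʳ (newton-node b j<k)) (zeroˡ _)
  ... | inj₂ ≡.refl = trans (*-congˡ (-‿inverseʳ _)) (zeroʳ _)

  newton-≈[] : ∀ I {b b′} → (∀ j → b j ≈[ I ] b′ j) → ∀ k {x x′} → x ≈[ I ] x′ →
               newton b k x ≈[ I ] newton b′ k x′
  newton-≈[] I b≈b′ zero    x≈x′ = ≈⇒≈[] I refl
  newton-≈[] I b≈b′ (suc k) x≈x′ =
    Mod.*-cong I (newton-≈[] I b≈b′ k x≈x′) (Mod.+-cong I x≈x′ (Mod.-‿cong I (b≈b′ k)))

  newton-cong : ∀ b k {x x′} → x ≈ x′ → newton b k x ≈ newton b k x′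
  newton-cong b zero    x≈x′ = refl
  newton-cong b (suc k) x≈x′ = *-cong (newton-cong b k x≈x′) (+-congʳ x≈x′)

  expand-≈[] : ∀ I b a m {x x′} → x ≈[ I ] x′ → expand b a m x ≈[ I ] expand b a m x′
  expand-≈[] I b a zero    x≈x′ = ≈⇒≈[] I refl
  expand-≈[] I b a (suc m) x≈x′ = Mod.+-cong I (expand-≈[] I b a m x≈x′)
    (Mod.*-congˡ I (newton-≈[] I (λ j → ≈⇒≈[] I refl) m x≈x′))

  expand-cong : ∀ b {a a′} m x → (∀ k → a k ≈ a′ k) → expand b a m x ≈ expand b a′ m x
  expand-cong b zero    x e = refl
  expand-cong b (suc m) x e = +-cong (expand-cong b m x e) (*-congʳ (e m))

  expand-+ : ∀ b a a′ m x → expand b (λ k → a k + a′ k) m x ≈ expand b a m x + expand b a′ m x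
  expand-+ b a a′ zero    x = sym (+-identityˡ 0#)
  expand-+ b a a′ (suc m) x = trans (+-congʳ (expand-+ b a a′ m x))
    (solve 5 (λ s s′ u u′ g → (s :+ s′) :+ (u :+ u′) :* g := (s :+ u :* g) :+ (s′ :+ u′ :* g)) refl
      _ _ (a m) (a′ m) (newton b m x))

  expand-* : ∀ b d a m x → expand b (λ k → d * a k) m x ≈ d * expand b a m x
  expand-* b d a zero    x = sym (zeroʳ d)
  expand-* b d a (suc m) x = trans (+-congʳ (expand-* b d a m x))
    (solve 4 (λ d s u g → d :* s :+ (d :* u) :* g := d :* (s :+ u :* g)) refl d _ (a m) (newton b m x))

  expand-∈ : ∀ I b a m {x} → (∀ {j} → j ℕ.< m → a j * newton b j x ∈ ⟦ I ⟧) → expand b a m x ∈ ⟦ I ⟧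
  expand-∈ I b a zero    f = Ideal.0∈ I
  expand-∈ I b a (suc m) f = Ideal.+-closed I (expand-∈ I b a m (f ∘ ℕ.m<n⇒m<1+n)) (f ℕ.≤-refl)

  ∈-cancelˡ : ∀ I {x y} → x ∈ ⟦ I ⟧ → x + y ∈ ⟦ I ⟧ → y ∈ ⟦ I ⟧
  ∈-cancelˡ I {x} {y} p q = ∈-resp I (solve 2 (λ x y → y := (x :+ y) :- x) refl x y) (∈-sub I q p)

  ∈-cancelʳ : ∀ I {x y} → y ∈ ⟦ I ⟧ → x + y ∈ ⟦ I ⟧ → x ∈ ⟦ I ⟧
  ∈-cancelʳ I p q = ∈-cancelˡ I p (∈-resp I (+-comm _ _) q)

  expand-isolate : ∀ I b a m {t x} → t ℕ.< m → expand b a m x ∈ ⟦ I ⟧ →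
                   (∀ {j} → j ≢ t → a j * newton b j x ∈ ⟦ I ⟧) → a t * newton b t x ∈ ⟦ I ⟧
  expand-isolate I b a (suc m) (s≤s t≤m) Σ∈I others with ℕ.m≤n⇒m<n∨m≡n t≤m
  ... | inj₁ t<m    = expand-isolate I b a m t<m (∈-cancelʳ I (others (ℕ.<⇒≢ t<m ∘ ≡.sym)) Σ∈I) others
  ... | inj₂ ≡.refl = ∈-cancelˡ I (expand-∈ I b a m (others ∘ ℕ.<⇒≢)) Σ∈I

  shift : (ℕ → Carrier) → ℕ → Carrier
  shift a zero    = 0#
  shift a (suc k) = a k

  -- This is x N_k = N_{k+1} + b_k N_k summed up. The overflow in degree m is kept apart: modulo J
  -- it can be discarded, and in `newton-monic` it becomes the new leading term.
  x*expand : ∀ b a m x → x * expand b a m x ≈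
             expand b (λ k → shift a k + b k * a k) m x + shift a m * newton b m x
  x*expand b a zero    x = solve 1 (λ x → x :* con 0ℤ := con 0ℤ :+ con 0ℤ :* con 1ℤ) refl x
  x*expand b a (suc m) x = begin
    x * (expand b a m x + a m * g)
      ≈⟨ solve 4 (λ x s u g → x :* (s :+ u :* g) := x :* s :+ x :* (u :* g)) refl x _ (a m) g ⟩
    x * expand b a m x + x * (a m * g)
      ≈⟨ +-congʳ (x*expand b a m x) ⟩
    (s + shift a m * g) + x * (a m * g)
      ≈⟨ solve 6 (λ s h g x u v → (s :+ h :* g) :+ x :* (u :* g) :=
                   (s :+ (h :+ v :* u) :* g) :+ u :* (g :* (x :- v))) refl s (shift a m) g x (a m) (b m) ⟩
    (s + (shift a m + b m * a m) * g) + a m * (g * (x - b m)) ∎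
    where
      g = newton b m x
      s = expand b (λ k → shift a k + b k * a k) m x

  -- Multiplication by x - b′_k shifts the coefficients and adds (b_j - b′_k) a_j, so the leading 1
  -- moves up. The vanishing above k is carried along to identify the overflow of `x*expand` with
  -- the new coefficient at `suc k`.
  newton-monic : ∀ b b′ k → ∃[ a ] a k ≈ 1# × (∀ {j} → k ℕ.< j → a j ≈ 0#) ×
                 (∀ x → newton b′ k x ≈ expand b a (suc k) x)
  newton-monic b b′ zero = (λ { zero → 1# ; (suc _) → 0# }) , refl , (λ { (s≤s _) → refl }) ,
    λ x → solve 0 (con 1ℤ := con 0ℤ :+ con 1ℤ :* con 1ℤ) refl
  newton-monic b b′ (suc k) with newton-monic b b′ k
  ... | a , ak≈1 , a≈0 , eq = a′ ,
        trans (+-cong (+-cong ak≈1 (*-congˡ (a≈0 ℕ.≤-refl))) (*-congˡ (a≈0 ℕ.≤-refl)))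
          (solve 2 (λ u v → (con 1ℤ :+ u :* con 0ℤ) :+ v :* con 0ℤ := con 1ℤ) refl _ _) ,
        (λ { {suc j} (s≤s k<j) →
          trans (+-cong (+-cong (a≈0 k<j) (*-congˡ (a≈0 (ℕ.m<n⇒m<1+n k<j)))) (*-congˡ (a≈0 (ℕ.m<n⇒m<1+n k<j))))
          (solve 2 (λ u v → (con 0ℤ :+ u :* con 0ℤ) :+ v :* con 0ℤ := con 0ℤ) refl _ _) }) ,
        eq′
    where
      a′ : ℕ → Carrier
      a′ j = (shift a j + b j * a j) + (- b′ k) * a j

      eq′ : ∀ x → newton b′ k x * (x - b′ k) ≈ expand b a′ (suc (suc k)) x
      eq′ x = begin
        newton b′ k x * (x - b′ k)
          ≈⟨ *-congʳ (eq x) ⟩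
        E * (x - b′ k)
          ≈⟨ solve 3 (λ E x v → E :* (x :- v) := x :* E :+ (:- v) :* E) refl E x (b′ k) ⟩
        x * E + (- b′ k) * E
          ≈⟨ +-cong (x*expand b a (suc k) x) (sym (expand-* b (- b′ k) a (suc k) x)) ⟩
        (expand b (λ j → shift a j + b j * a j) (suc k) x + a k * g) + expand b (λ j → (- b′ k) * a j) (suc k) x
          ≈⟨ solve 3 (λ p q r → (p :+ q) :+ r := (p :+ r) :+ q) refl _ _ _ ⟩
        (expand b (λ j → shift a j + b j * a j) (suc k) x + expand b (λ j → (- b′ k) * a j) (suc k) x) + a k * g
          ≈⟨ +-cong (sym (expand-+ b _ _ (suc k) x)) (*-congʳ top) ⟩
        expand b a′ (suc k) x + a′ (suc k) * g ∎
        where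
          E = expand b a (suc k) x
          g = newton b (suc k) x

          top : a k ≈ (a k + b (suc k) * a (suc k)) + (- b′ k) * a (suc k)
          top = sym (trans (+-cong (+-congˡ (*-congˡ (a≈0 ℕ.≤-refl))) (*-congˡ (a≈0 ℕ.≤-refl)))
            (solve 3 (λ w u v → (w :+ u :* con 0ℤ) :+ v :* con 0ℤ := w) refl _ _ _))

  -- The P-orderings of 𝒟 have this property for powers Z of P.  The nodes need
  -- only be close to 𝒟, so that nodes adapted to several Z can be glued.
  record Adapted {p : Level} (Z : Ideal) (𝒟 : Pred Carrier p) (b : ℕ → Carrier) : Set (p ⊔ c ⊔ ℓ) where
    field
      near    : ∀ k → ∃[ d ] d ∈ 𝒟 × b k ≈[ Z ] d
      divides : ∀ k {x} → x ∈ 𝒟 → newton b k x ∈ ⟦ ⟨ pivot b k ⟩ +ᵢ Z ⟧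

  module _ {p : Level} {𝒟 : Pred Carrier p} where

    adapted-mono : ∀ Z Z′ {b} → Z ⊆ᵢ Z′ → Adapted Z 𝒟 b → Adapted Z′ 𝒟 b
    adapted-mono Z Z′ {b} Z⊆Z′ A = record
      { near    = λ k → let d , d∈𝒟 , b≈d = near k in d , d∈𝒟 , Z⊆Z′ b≈d
      ; divides = λ k x∈𝒟 → +ᵢ-mono {I = ⟨ pivot b k ⟩} {I′ = ⟨ pivot b k ⟩} {J = Z} {J′ = Z′} id Z⊆Z′ (divides k x∈𝒟)
      } where open Adapted A

    +-∈ : ∀ Z {x x′ y y′} → x ≈[ Z ] x′ → y ≈[ Z ] y′ → x ∈ ⟦ ⟨ y ⟩ +ᵢ Z ⟧ → x′ ∈ ⟦ ⟨ y′ ⟩ +ᵢ Z ⟧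
    +-∈ Z {x} {x′} {y} {y′} x≈x′ y≈y′ (u , z , lift (t , e) , z∈Z , e′) =
      t * y′ , (t * (y - y′) + z) - (x - x′) , *∈⟨⟩ t y′ ,
      ∈-sub Z (Ideal.+-closed Z (Ideal.*-closed Z t y≈y′) z∈Z) x≈x′ ,
      (begin
        x′ ≈⟨ solve 5 (λ x x′ ty ty′ z → x′ := (ty′ :+ ((ty :- ty′) :+ z :- (x :- x′))) :+ (x :- (ty :+ z))) refl x x′ (t * y) (t * y′) z ⟩
        (t * y′ + ((t * y - t * y′) + z - (x - x′))) + (x - (t * y + z))
          ≈⟨ +-congˡ (trans (+-congʳ (trans e′ (+-congʳ e))) (-‿inverseʳ _)) ⟩
        (t * y′ + ((t * y - t * y′) + z - (x - x′))) + 0#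
          ≈⟨ solve 6 (λ t y y′ z x x′ → (t :* y′ :+ ((t :* y :- t :* y′) :+ z :- (x :- x′))) :+ con 0ℤ
               := t :* y′ :+ ((t :* (y :- y′) :+ z) :- (x :- x′))) refl t y y′ z x x′ ⟩
        t * y′ + ((t * (y - y′) + z) - (x - x′)) ∎)

    adapted-≈[] : ∀ Z {b b′} → (∀ k → b′ k ≈[ Z ] b k) → Adapted Z 𝒟 b → Adapted Z 𝒟 b′
    adapted-≈[] Z {b} {b′} b′≈b A = record
      { near    = λ k → let d , d∈𝒟 , b≈d = near k in d , d∈𝒟 , Mod.trans Z (b′≈b k) b≈d
      ; divides = λ k x∈𝒟 → +-∈ Z (newton-≈[] Z b≈b′ k (Mod.refl Z)) (newton-≈[] Z b≈b′ k (b≈b′ k)) (divides k x∈𝒟)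
      } where
        open Adapted A
        b≈b′ : ∀ k → b k ≈[ Z ] b′ k
        b≈b′ k = Mod.sym Z (b′≈b k)

    module _ (Z : Ideal) {b : ℕ → Carrier} (A : Adapted Z 𝒟 b) where
      open Adapted A

      divides-node : ∀ k t → newton b k (b t) ∈ ⟦ ⟨ pivot b k ⟩ +ᵢ Z ⟧
      divides-node k t with near t
      ... | d , d∈𝒟 , bt≈d = +-∈ Z (newton-≈[] Z (λ _ → Mod.refl Z) k (Mod.sym Z bt≈d)) (Mod.refl Z) (divides k d∈𝒟)

      -- Triangular elimination at the nodes in increasing order. At b_t the terms with j > t
      -- contain the factor b_t - b_t. For j < t, N_j(b_t) is a multiple of the j-th pivot modulo Z,
      -- and the induction hypothesis applies.
      coefficients-vanish : ∀ a m → (∀ {x} → x ∈ 𝒟 → expand b a m x ∈ ⟦ Z ⟧) →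
                            ∀ {t} → t ℕ.< m → a t * pivot b t ∈ ⟦ Z ⟧
      coefficients-vanish a m null {t} = <-rec (λ t → t ℕ.< m → a t * pivot b t ∈ ⟦ Z ⟧) step t
        where
          at-node : ∀ t → expand b a m (b t) ∈ ⟦ Z ⟧
          at-node t with near t
          ... | d , d∈𝒟 , bt≈d = ∈-resp-≈[] Z (expand-≈[] Z b a m bt≈d) (null d∈𝒟)

          step : ∀ t → (∀ {j} → j ℕ.< t → j ℕ.< m → a j * pivot b j ∈ ⟦ Z ⟧) → t ℕ.< m → a t * pivot b t ∈ ⟦ Z ⟧
          step t ih t<m = expand-isolate Z b a m t<m (at-node t) λ {j} j≢t → others j j≢t
            where
              others : ∀ j → j ≢ t → a j * newton b j (b t) ∈ ⟦ Z ⟧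
              others j j≢t with ℕ.<-cmp j t
              ... | tri< j<t _ _ = *∈-⟨⟩+ Z (a j) (pivot b j) (ih j<t (ℕ.<-trans j<t t<m)) (divides-node j t)
              ... | tri≈ _ j≡t _ = contradiction j≡t j≢t
              ... | tri> _ _ t<j = ∈-resp Z (trans (*-congˡ (newton-node b t<j)) (zeroʳ _)) (Ideal.0∈ Z)

      -- Expanded in the basis of b, the polynomial of b′ has k-th coefficient 1, so
      -- `coefficients-vanish` at t = k gives the bare pivot.
      pivot-minimal : ∀ b′ k → (∀ {x} → x ∈ 𝒟 → newton b′ k x ∈ ⟦ Z ⟧) → pivot b k ∈ ⟦ Z ⟧
      pivot-minimal b′ k null with newton-monic b b′ k
      ... | a , ak≈1 , _ , eq = ∈-resp Z (sym (trans (*-congʳ ak≈1) (*-identityˡ _)))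
        (coefficients-vanish a (suc k) (λ {x} x∈𝒟 → ∈-resp Z (sym (eq x)) (null x∈𝒟)) ℕ.≤-refl)

    -- Modulo `⟨ pivot b′ k ⟩ +ᵢ Z` the polynomial of b′ vanishes on 𝒟, since b′ is adapted. By
    -- symmetry both pivots generate the same ideal modulo Z, which is the independence of v_k from
    -- the ordering.
    pivot-unique : ∀ Z {b b′} → Adapted Z 𝒟 b → Adapted Z 𝒟 b′ → ∀ k → pivot b k ∈ ⟦ ⟨ pivot b′ k ⟩ +ᵢ Z ⟧
    pivot-unique Z {b} {b′} A A′ k = pivot-minimal Z′ (adapted-mono Z Z′ (+ᵢ-inʳ ⟨ pivot b′ k ⟩ Z) A) b′ k
        (λ x∈𝒟 → Adapted.divides A′ k x∈𝒟)
      where Z′ = ⟨ pivot b′ k ⟩ +ᵢ Z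

-- Excluded middle, and local principality at a nonzero prime.

module _ {c ℓ : Level} (D : CommutativeRing c ℓ) where
  open CommutativeRing D hiding (zero)
  open Ideals D
  open IdealProperties D

  -- The classes of 1 and 0 modulo `J∨A` have the same index in `Fin n` exactly if 1 ∈ J or A holds.
  -- As 1 ∉ J, comparing the two indices decides A.
  excludedMiddle : FiniteNormProperty → ∀ J → ¬ (J ≐ᵢ 0ᵢ) → ¬ (J ≐ᵢ 1ᵢ) → (A : Set (c ⊔ ℓ)) → Dec A
  excludedMiddle fnp J J≠0 J≠1 A with fnp J∨A J∨A≠0
    where
      J∨A : Ideal
      J∨A = record
        { members  = λ x → x ∈ ⟦ J ⟧ ⊎ A
        ; respects = λ e → Sum.map₁ (Ideal.respects J e)
        ; 0∈       = inj₁ (Ideal.0∈ J)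
        ; +-closed = λ { (inj₁ p) (inj₁ q) → inj₁ (Ideal.+-closed J p q)
                       ; (inj₁ p) (inj₂ a) → inj₂ a ; (inj₂ a) _ → inj₂ a }
        ; *-closed = λ d → Sum.map₁ (Ideal.*-closed J d)
        }
      J∨A≠0 : ¬ (J∨A ≐ᵢ 0ᵢ)
      J∨A≠0 (J∨A⊆0 , _) = J≠0 ((λ p → J∨A⊆0 (inj₁ p)) ,
        λ { (lift x≈0) → ∈-resp J x≈0 (Ideal.0∈ J) })
  ... | n , inv with Inverse.to inv 1# Fin.≟ Inverse.to inv 0#
  ...   | no  1≁0 = no λ a → 1≁0 (Inverse.to-cong inv (inj₂ a))
  ...   | yes 1~0 with Inverse.inverseʳ inv 1~0 | Inverse.strictlyInverseʳ inv 1#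
  ...     | inj₂ a | _      = yes a
  ...     | _      | inj₂ a = yes a
  ...     | inj₁ p | inj₁ q = ⊥-elim (J≠1 (1∈⇒≐1 J
            (≈[]0⇒∈ J (Mod.trans J (Mod.sym J q) p))))

  module Residues (I : Ideal) {n : ℕ} (inv : HasCardinality (Mod.setoid I) n) where
    open Inverse inv using (to; from)

    rep : Fin n → Carrier
    rep = from

    index : Carrier → Fin n
    index = to

    ≈rep : ∀ x → x ≈[ I ] rep (index x)
    ≈rep x = Mod.sym I (Inverse.strictlyInverseʳ inv x)

    recurrence : (s : ℕ → Carrier) → ∃[ i ] ∃[ j ] i ℕ.< j × s i ≈[ I ] s j
    recurrence s with Fin.pigeonhole (ℕ.n<1+n n) (to ∘ s ∘ toℕ)
    ... | i , j , i<j , eq = toℕ i , toℕ j , i<j ,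
      Mod.trans I (≈rep (s (toℕ i))) (≡.subst (λ k → rep k ≈[ I ] s (toℕ j)) (≡.sym eq) (Mod.sym I (≈rep _)))

  module LocalPrime
    (isIntegralDomain : IsIntegralDomain)
    (integrallyClosed : ∀ a b → ¬ (b ≈ 0#) → IsIntegralFraction a b → ∃[ q ] a ≈ q * b)
    (fnp : FiniteNormProperty)
    (em : (A : Set (c ⊔ ℓ)) → Dec A)
    (P : Ideal) (P-prime : IsPrimeIdeal P) (P≠0 : ¬ (P ≐ᵢ 0ᵢ)) (P-maximal : IsMaximalIdeal P)
    where
    open RawSemiringDefinitions (Semiring.rawSemiring semiring) using (sum; _^_) renaming (product to ∏)
    open IntegerSolver D using (solve; con; _:+_; _:*_; _:-_; :-_; _:=_)
    open import Algebra.Properties.Semiring.Exp semiring using (^-homo-*)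
    open IsIntegralDomain isIntegralDomain
    open IsPrimeIdeal P-prime
    open import Relation.Binary.Reasoning.Setoid setoid

    x-y≈0⇒x≈y : ∀ {x y} → x - y ≈ 0# → x ≈ y
    x-y≈0⇒x≈y {x} {y} e = trans (solve 2 (λ x y → x := (x :- y) :+ y) refl x y) (trans (+-congʳ e) (+-identityˡ y))

    *-cancelˡ : ∀ u {x y} → ¬ (u ≈ 0#) → u * x ≈ u * y → x ≈ y
    *-cancelˡ u {x} {y} u≉0 e with noZeroDivisors {u} {x - y}
      (trans (solve 3 (λ u x y → u :* (x :- y) := u :* x :- u :* y) refl u x y) (trans (+-congʳ e) (-‿inverseʳ _)))
    ... | inj₁ u≈0   = contradiction u≈0 u≉0
    ... | inj₂ x-y≈0 = x-y≈0⇒x≈y x-y≈0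

    ^≉0 : ∀ {u} n → ¬ (u ≈ 0#) → ¬ (u ^ n ≈ 0#)
    ^≉0 zero    u≉0 e = 1≉0 e
    ^≉0 (suc n) u≉0 e = ^≉0 n u≉0 (*-cancelˡ _ u≉0 (trans e (sym (zeroʳ _))))

    1∉P : 1# ∉ ⟦ P ⟧
    1∉P = proper ∘ 1∈⇒≐1 P

    *∉P : ∀ {x y} → x ∉ ⟦ P ⟧ → y ∉ ⟦ P ⟧ → x * y ∉ ⟦ P ⟧
    *∉P x∉P y∉P = Sum.[ x∉P , y∉P ] ∘ prime

    ^∉P : ∀ {x} n → x ∉ ⟦ P ⟧ → x ^ n ∉ ⟦ P ⟧
    ^∉P zero    x∉P = 1∉P
    ^∉P (suc n) x∉P = *∉P x∉P (^∉P n x∉P)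

    ∏∉P : ∀ {n} {s : Vector Carrier n} → (∀ i → s i ∉ ⟦ P ⟧) → ∏ s ∉ ⟦ P ⟧
    ∏∉P {zero}  f = 1∉P
    ∏∉P {suc n} f = *∉P (f zero) (∏∉P (f ∘ suc))

    factor∣∏ : ∀ {n} (s : Vector Carrier n) i → ∃[ t ] ∏ s ≈ t * s i
    factor∣∏ s zero    = ∏ (tail s) , *-comm _ _
    factor∣∏ s (suc i) = let t , e = factor∣∏ (tail s) i in
      s zero * t , trans (*-congˡ e) (sym (*-assoc _ _ _))

    ∉P⇒≉0 : ∀ {x} → x ∉ ⟦ P ⟧ → ¬ (x ≈ 0#)
    ∉P⇒≉0 x∉P x≈0 = x∉P (∈-resp P x≈0 (Ideal.0∈ P))

    1-p∉P : ∀ {p} → p ∈ ⟦ P ⟧ → 1# - p ∉ ⟦ P ⟧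
    1-p∉P {p} p∈P q = 1∉P (∈-resp P (solve 1 (λ p → con 1ℤ := p :+ (con 1ℤ :- p)) refl p) (Ideal.+-closed P p∈P q))

    nonzero-element : ∃[ a ] a ∈ ⟦ P ⟧ × ¬ (a ≈ 0#)
    nonzero-element = decidable-stable (em _) λ ¬∃ → P≠0
      ((λ {x} x∈P → decidable-stable (em (x ∈ ⟦ 0ᵢ ⟧)) λ x≉0 → ¬∃ (x , x∈P , x≉0 ∘ lift)) ,
       λ { (lift x≈0) → ∈-resp P x≈0 (Ideal.0∈ P) })

    ∉P⇒comaximal : ∀ {s} → s ∉ ⟦ P ⟧ → Comaximal ⟨ s ⟩ P
    ∉P⇒comaximal {s} s∉P = fromSum (proj₂ ≐1 tt)
      where
        ≐1 : ⟨ s ⟩ +ᵢ P ≐ᵢ 1ᵢ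
        ≐1 = IsMaximalIdeal.maximal P-maximal (⟨ s ⟩ +ᵢ P)
          (+ᵢ-inʳ ⟨ s ⟩ P , λ f → s∉P (f (+ᵢ-inˡ ⟨ s ⟩ P (∈⟨⟩ s))))
        fromSum : 1# ∈ ⟦ ⟨ s ⟩ +ᵢ P ⟧ → Comaximal ⟨ s ⟩ P
        fromSum (a , b , p , q , e) = a , p , ∈-resp P
          (trans (+-congʳ e) (solve 2 (λ a b → (a :+ b) :- a := b) refl a b)) q

    inverse-mod-^ : ∀ {s} → s ∉ ⟦ P ⟧ → ∀ e → ∃[ t ] 1# - t * s ∈ ⟦ P ^ᵢ e ⟧
    inverse-mod-^ {s} s∉P e =
      let z , lift (t , z≈ts) , 1-z∈ = comaximal-^ ⟨ s ⟩ P (∉P⇒comaximal s∉P) e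
      in t , ∈-resp (P ^ᵢ e) (+-congˡ (-‿cong (sym z≈ts))) 1-z∈

    ∈^-cancelˡ : ∀ {s x} e → s ∉ ⟦ P ⟧ → s * x ∈ ⟦ P ^ᵢ e ⟧ → x ∈ ⟦ P ^ᵢ e ⟧
    ∈^-cancelˡ {s} {x} e s∉P sx∈ =
      let t , 1-ts∈ = inverse-mod-^ s∉P e
      in ∈-resp (P ^ᵢ e) (solve 3 (λ s t x → x := t :* (s :* x) :+ (con 1ℤ :- t :* s) :* x) refl s t x)
           (Ideal.+-closed (P ^ᵢ e) (Ideal.*-closed (P ^ᵢ e) t sx∈) (∈-*ʳ (P ^ᵢ e) 1-ts∈))

    sum-single : ∀ {n} (h : Vector Carrier n) i d → Σ (Vector Carrier n) λ t → sum (λ j → t j * h j) ≈ d * h i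
    sum-single h zero    d = (d ∷ᶠ λ _ → 0#) , trans (+-congˡ (zeros (tail h))) (+-identityʳ _)
      where
        zeros : ∀ {n} (h : Vector Carrier n) → sum (λ j → 0# * h j) ≈ 0#
        zeros {zero}  h = refl
        zeros {suc n} h = trans (+-cong (zeroˡ _) (zeros (tail h))) (+-identityˡ 0#)
    sum-single h (suc i) d =
      let t , e = sum-single (tail h) i d
      in (0# ∷ᶠ t) , trans (+-cong (zeroˡ _) e) (+-identityˡ _)

    sum-distrib : ∀ {n} (s t h : Vector Carrier n) →
                  sum (λ j → (s j + t j) * h j) ≈ sum (λ j → s j * h j) + sum (λ j → t j * h j)
    sum-distrib {zero}  s t h = sym (+-identityˡ 0#)
    sum-distrib {suc n} s t h = trans (+-congˡ (sum-distrib (tail s) (tail t) (tail h)))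
      (solve 5 (λ s t h u v → (s :+ t) :* h :+ (u :+ v) := (s :* h :+ u) :+ (t :* h :+ v)) refl
        (s zero) (t zero) (h zero) _ _)

    sum-cong : ∀ {n} {s t : Vector Carrier n} → (∀ j → s j ≈ t j) → sum s ≈ sum t
    sum-cong {zero}  e = refl
    sum-cong {suc n} e = +-cong (e zero) (sum-cong (e ∘ suc))

    -- The monic equation is t^j - t^i + q = 0 for t = b/a. Its lower coefficients are built as a
    -- sum of two one-entry vectors because both entries sit at index 0 when i = 0.
    integral : ∀ a b {i j} q → i ℕ.< j → b ^ j + (q * a ^ j - b ^ i * a ^ (j ∸ i)) ≈ 0# → IsIntegralFraction b a
    integral a b {i} {suc j′} q i<j e =
      let s , es = sum-single h zero q
          t , et = sum-single h (Fin.fromℕ< i<j) (- 1#)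
      in j , (λ k → s k + t k) , (begin
      b ^ j + sum (λ k → (s k + t k) * b ^ toℕ k * a ^ (j ∸ toℕ k))
        ≈⟨ +-congˡ (sum-cong {j} {λ k → (s k + t k) * b ^ toℕ k * a ^ (j ∸ toℕ k)} {λ k → (s k + t k) * h k} (λ k → *-assoc _ _ _)) ⟩
      b ^ j + sum (λ k → (s k + t k) * h k)
        ≈⟨ +-congˡ (sum-distrib s t h) ⟩
      b ^ j + (sum (λ k → s k * h k) + sum (λ k → t k * h k))
        ≈⟨ +-congˡ (+-cong es et) ⟩
      b ^ j + (q * (1# * a ^ j) + (- 1#) * h (Fin.fromℕ< i<j))
        ≈⟨ +-congˡ (+-congˡ (*-congˡ (reflexive (≡.cong (λ k → b ^ k * a ^ (j ∸ k)) (Fin.toℕ-fromℕ< i<j))))) ⟩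
      b ^ j + (q * (1# * a ^ j) + (- 1#) * (b ^ i * a ^ (j ∸ i)))
        ≈⟨ +-congˡ (solve 3 (λ q x y → q :* (con 1ℤ :* x) :+ (:- con 1ℤ) :* y := q :* x :- y) refl q _ _) ⟩
      b ^ j + (q * a ^ j - b ^ i * a ^ (j ∸ i))
        ≈⟨ e ⟩
      0# ∎)
      where
        j = suc j′
        h : Vector Carrier j
        h k = b ^ toℕ k * a ^ (j ∸ toℕ k)

    module Uniformiser (a : Carrier) (a∈P : a ∈ ⟦ P ⟧) (a≉0 : ¬ (a ≈ 0#))
                       {n : ℕ} (inv : HasCardinality (Mod.setoid ⟨ a ⟩) n) where
      open Residues ⟨ a ⟩ inv

      ⟨a⟩⊆P : ⟨ a ⟩ ⊆ᵢ P
      ⟨a⟩⊆P = ⟨⟩-least P a∈P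

      -- The kernel of localising D/⟨a⟩ at P.
      Killed : Carrier → Set (c ⊔ ℓ)
      Killed x = ∃[ s ] s ∉ ⟦ P ⟧ × s * x ∈ ⟦ ⟨ a ⟩ ⟧

      ¬Killed-1 : ¬ Killed 1#
      ¬Killed-1 (s , s∉P , e) = s∉P (∈-resp P (sym (*-identityʳ s)) (⟨a⟩⊆P e))

      Escape : ∃[ x ] ¬ Killed x → Set (c ⊔ ℓ)
      Escape (x , _) = ∃[ p ] p ∈ ⟦ P ⟧ × ¬ Killed (p * x)

      -- Otherwise 1 could be multiplied by elements of P forever without being
      -- killed, but p x ≡ x with p ∈ P implies that 1 - p kills x.
      ¬all-escape : (∀ x → Escape x) → ⊥
      ¬all-escape next = collide (recurrence (proj₁ ∘ chain))
        where
          chain : ℕ → ∃[ x ] ¬ Killed x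
          chain zero    = 1# , ¬Killed-1
          chain (suc k) = proj₁ (next (chain k)) * proj₁ (chain k) , proj₂ (proj₂ (next (chain k)))

          steps : ∀ {i j} → i ℕ.<′ j → ∃[ p ] p ∈ ⟦ P ⟧ × proj₁ (chain j) ≈ p * proj₁ (chain i)
          steps {i} ℕ.<′-base = let p , p∈P , _ = next (chain i) in p , p∈P , refl
          steps {i} (ℕ.<′-step {j} i<j) =
            let p , p∈P , e = steps i<j
                q , q∈P , _ = next (chain j)
            in q * p , Ideal.*-closed P q p∈P , trans (*-congˡ e) (sym (*-assoc _ _ _))

          collide : ∃[ i ] ∃[ j ] i ℕ.< j × proj₁ (chain i) ≈[ ⟨ a ⟩ ] proj₁ (chain j) → ⊥
          collide (i , j , i<j , eq) =
            let p , p∈P , e = steps (ℕ.<⇒<′ i<j)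
            in proj₂ (chain i) (1# - p , 1-p∉P p∈P , ∈-resp ⟨ a ⟩
              (trans (solve 2 (λ p x → (con 1ℤ :- p) :* x := x :- p :* x) refl p _) (+-congˡ (-‿cong (sym e)))) eq)

      -- A nonzero element annihilated by P in the localisation of D/⟨a⟩ at P. Without one, every
      -- unkilled element could be multiplied by some element of P and stay unkilled, against
      -- `¬all-escape`.
      socle : ∃[ x ] ¬ Killed x × (∀ {p} → p ∈ ⟦ P ⟧ → Killed (p * x))
      socle = decidable-stable (em _) λ ¬∃ → ¬all-escape λ (x , ¬K) → decidable-stable (em _) λ ¬q →
        ¬∃ (x , ¬K , λ {p} p∈P → decidable-stable (em (Killed (p * x))) λ ¬Kp → ¬q (p , p∈P , ¬Kp))

      -- b/a is not in D, but multiplies P into D.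
      multiplier : ∃[ b ] b ∉ ⟦ ⟨ a ⟩ ⟧ × (∀ {p} → p ∈ ⟦ P ⟧ → b * p ∈ ⟦ ⟨ a ⟩ ⟧)
      multiplier = ∏ s * x , (λ e → ¬K (∏ s , ∏∉P s∉P , e)) , λ {p} p∈P → kill p (K p∈P) (factor∣∏ s (index (p * x)))
        where
          x  = proj₁ socle
          ¬K = proj₁ (proj₂ socle)
          K  = proj₂ (proj₂ socle)

          -- The element killing p x depends on p, but p x meets only finitely many classes modulo
          -- ⟨a⟩. One killer per class is chosen, with 1 for classes that are not killed; their
          -- product is outside P and works for all p at once.
          Killer : Fin n → Set (c ⊔ ℓ)
          Killer i = ∃[ s ] s ∉ ⟦ P ⟧ × (Killed (rep i) → s * rep i ∈ ⟦ ⟨ a ⟩ ⟧)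

          choice : ∀ i → Killer i
          choice i = case em (Killed (rep i)) of λ where
            (yes (s , s∉P , e)) → s , s∉P , λ _ → e
            (no ¬Ki)            → 1# , 1∉P , λ Ki → contradiction Ki ¬Ki

          s : Vector Carrier n
          s i = proj₁ (choice i)

          s∉P : ∀ i → s i ∉ ⟦ P ⟧
          s∉P i = proj₁ (proj₂ (choice i))

          kill : ∀ p → Killed (p * x) → ∃[ t ] ∏ s ≈ t * s (index (p * x)) → (∏ s * x) * p ∈ ⟦ ⟨ a ⟩ ⟧
          kill p (u , u∉P , upx∈) (t , e) = ∈-resp ⟨ a ⟩
              (trans (solve 3 (λ p s x → (s :* x) :* p := s :* (p :* x)) refl p (∏ s) x) (*-congʳ e))
              (∈-resp-≈[] ⟨ a ⟩ (Mod.*-congˡ ⟨ a ⟩ {t * s (index (p * x))} (≈rep (p * x)))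
                (∈-resp ⟨ a ⟩ (*-assoc _ _ _) (Ideal.*-closed ⟨ a ⟩ t (proj₂ (proj₂ (choice (index (p * x))))
                  (u , u∉P , ∈-resp-≈[] ⟨ a ⟩ (Mod.*-congˡ ⟨ a ⟩ {u} (Mod.sym ⟨ a ⟩ (≈rep (p * x)))) upx∈)))))

      -- Otherwise multiplication by b/a maps P to itself; since D/⟨a⟩ is finite,
      -- (b/a)ⁱ - (b/a)ʲ ∈ D for some i < j, making b/a integral.
      module _ (b : Carrier) (b∉⟨a⟩ : b ∉ ⟦ ⟨ a ⟩ ⟧) (quotient : ∀ {p} → p ∈ ⟦ P ⟧ → ∃[ y ] b * p ≈ y * a) where

        P-unstable : (∀ {p y} → p ∈ ⟦ P ⟧ → b * p ≈ y * a → y ∈ ⟦ P ⟧) → ⊥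
        P-unstable stable = collide (recurrence (proj₁ ∘ power))
          where
            -- `power k` is a (b/a)^k; stability keeps it in P, where it can be multiplied by b/a
            -- again.
            power : ℕ → ∃[ y ] y ∈ ⟦ P ⟧
            power zero    = a , a∈P
            power (suc k) = let z , e = quotient (proj₂ (power k)) in z , stable (proj₂ (power k)) e

            power-eq : ∀ k → proj₁ (power k) * a ^ k ≈ a * b ^ k
            power-eq zero    = refl
            power-eq (suc k) = begin
              z * (a * a ^ k)             ≈⟨ *-assoc _ _ _ ⟨
              (z * a) * a ^ k             ≈⟨ *-congʳ (proj₂ (quotient (proj₂ (power k)))) ⟨
              (b * proj₁ (power k)) * a ^ k ≈⟨ *-assoc _ _ _ ⟩
              b * (proj₁ (power k) * a ^ k) ≈⟨ *-congˡ (power-eq k) ⟩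
              b * (a * b ^ k)             ≈⟨ solve 3 (λ a b u → b :* (a :* u) := a :* (b :* u)) refl a b (b ^ k) ⟩
              a * (b * b ^ k)             ∎
              where z = proj₁ (power (suc k))

            collide : ∃[ i ] ∃[ j ] i ℕ.< j × proj₁ (power i) ≈[ ⟨ a ⟩ ] proj₁ (power j) → ⊥
            collide (i , j , i<j , lift (q , e)) = b∉⟨a⟩ (lift (integrallyClosed b a a≉0
              (integral a b q i<j (*-cancelˡ a a≉0 (trans eq (sym (zeroʳ a)))))))
              where
                yi = proj₁ (power i)
                yj = proj₁ (power j)

                aʲ : a ^ j ≈ a ^ i * a ^ (j ∸ i)
                aʲ = trans (reflexive (≡.cong (a ^_) (≡.sym (ℕ.m+[n∸m]≡n (ℕ.<⇒≤ i<j))))) (^-homo-* a i (j ∸ i))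

                eq : a * (b ^ j + (q * a ^ j - b ^ i * a ^ (j ∸ i))) ≈ 0#
                eq = begin
                  a * (b ^ j + (q * a ^ j - b ^ i * a ^ (j ∸ i)))
                    ≈⟨ solve 6 (λ a bj q aj bi w → a :* (bj :+ (q :* aj :- bi :* w)) :=
                         a :* bj :+ ((q :* a) :* aj :- (a :* bi) :* w)) refl a (b ^ j) q (a ^ j) (b ^ i) (a ^ (j ∸ i)) ⟩
                  a * b ^ j + ((q * a) * a ^ j - (a * b ^ i) * a ^ (j ∸ i))
                    ≈⟨ +-cong (sym (power-eq j)) (+-cong (*-congʳ (sym e)) (-‿cong (*-congʳ (sym (power-eq i))))) ⟩
                  yj * a ^ j + ((yi - yj) * a ^ j - (yi * a ^ i) * a ^ (j ∸ i))
                    ≈⟨ solve 5 (λ yi yj aj ai w → yj :* aj :+ ((yi :- yj) :* aj :- (yi :* ai) :* w) :=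
                         yi :* (aj :- ai :* w)) refl yi yj (a ^ j) (a ^ i) (a ^ (j ∸ i)) ⟩
                  yi * (a ^ j - a ^ i * a ^ (j ∸ i))
                    ≈⟨ *-congˡ (trans (+-congʳ aʲ) (-‿inverseʳ _)) ⟩
                  yi * 0#
                    ≈⟨ zeroʳ yi ⟩
                  0# ∎

        unit-quotient : ∃[ p ] ∃[ y ] p ∈ ⟦ P ⟧ × y ∉ ⟦ P ⟧ × Lift c (b * p ≈ y * a)
        unit-quotient = decidable-stable (em _) λ ¬∃ → P-unstable λ {p} {y} p∈P e →
          decidable-stable (em (y ∈ ⟦ P ⟧)) λ y∉P → ¬∃ (p , y , p∈P , y∉P , lift e)

        b≉0 : ¬ (b ≈ 0#)
        b≉0 b≈0 = b∉⟨a⟩ (∈-resp ⟨ a ⟩ b≈0 (Ideal.0∈ ⟨ a ⟩))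

        -- Dividing b x = u a by b p = y a gives y x = u p. Since y is a unit at P, p generates P
        -- there.
        locally-principal : ∃[ p ] ∃[ y ] p ∈ ⟦ P ⟧ × y ∉ ⟦ P ⟧ × (∀ {x} → x ∈ ⟦ P ⟧ → ∃[ u ] y * x ≈ u * p)
        locally-principal =
          let p , y , p∈P , y∉P , lift e = unit-quotient
          in p , y , p∈P , y∉P , λ {x} x∈P →
            let u , e′ = quotient x∈P
            in u , *-cancelˡ b b≉0 (begin
              b * (y * x)  ≈⟨ solve 3 (λ b x y → b :* (y :* x) := y :* (b :* x)) refl b x y ⟩
              y * (b * x)  ≈⟨ *-congˡ e′ ⟩
              y * (u * a)  ≈⟨ solve 3 (λ y u a → y :* (u :* a) := u :* (y :* a)) refl y u a ⟩
              u * (y * a)  ≈⟨ *-congˡ e ⟨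
              u * (b * p)  ≈⟨ solve 3 (λ b u p → u :* (b :* p) := b :* (u :* p)) refl b u p ⟩
              b * (u * p)  ∎)

    uniformiser : ∃[ p ] ∃[ y ] p ∈ ⟦ P ⟧ × y ∉ ⟦ P ⟧ × (∀ {x} → x ∈ ⟦ P ⟧ → ∃[ u ] y * x ≈ u * p)
    uniformiser =
      let a , a∈P , a≉0 = nonzero-element
          _ , inv = fnp ⟨ a ⟩ λ (f , _) → a≉0 (lower (f (∈⟨⟩ a)))
          open Uniformiser a a∈P a≉0 inv
          b , b∉⟨a⟩ , kill = multiplier
      in locally-principal b b∉⟨a⟩ (λ p∈P → lower (kill p∈P))

    module _ (p y : Carrier) (p∈P : p ∈ ⟦ P ⟧) (y∉P : y ∉ ⟦ P ⟧)
             (divide : ∀ {x} → x ∈ ⟦ P ⟧ → ∃[ u ] y * x ≈ u * p) where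

      p^∈ : ∀ m → p ^ m ∈ ⟦ P ^ᵢ m ⟧
      p^∈ zero    = tt
      p^∈ (suc m) = ·ᵢ-in {I = P} {J = P ^ᵢ m} p∈P (p^∈ m)

      divide-^ : ∀ m {x} → x ∈ ⟦ P ^ᵢ m ⟧ → ∃[ u ] y ^ m * x ≈ u * p ^ m
      divide-^ zero    {x} _ = x , *-comm 1# x
      divide-^ (suc m) (empty x≈0) = 0# , trans (*-congˡ x≈0) (trans (zeroʳ _) (sym (zeroˡ _)))
      divide-^ (suc m) {x} (add {a = a} {b = b} {y = z} a∈P b∈P^m z∈ x≈) =
        let u , eu = divide a∈P
            v , ev = divide-^ m b∈P^m
            w , ew = divide-^ (suc m) z∈
        in u * v + w , (begin
          (y * y ^ m) * x
            ≈⟨ *-congˡ x≈ ⟩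
          (y * y ^ m) * (a * b + z)
            ≈⟨ solve 5 (λ y ym a b z → (y :* ym) :* (a :* b :+ z) := (y :* a) :* (ym :* b) :+ (y :* ym) :* z)
                 refl y (y ^ m) a b z ⟩
          (y * a) * (y ^ m * b) + (y * y ^ m) * z
            ≈⟨ +-cong (*-cong eu ev) ew ⟩
          (u * p) * (v * p ^ m) + w * (p * p ^ m)
            ≈⟨ solve 5 (λ u p v pm w → (u :* p) :* (v :* pm) :+ w :* (p :* pm) := (u :* v :+ w) :* (p :* pm))
                 refl u p v (p ^ m) w ⟩
          (u * v + w) * (p * p ^ m) ∎)

      -- Locally π = u p^m and x = v p^m up to the factor y^m. Here u ∉ P, for otherwise cancelling
      -- y^m would put π into P^(m+1). Hence u x = v π, and u is invertible modulo P^e.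
      generated : ∀ m {π x} → π ∈ ⟦ P ^ᵢ m ⟧ → π ∉ ⟦ P ^ᵢ suc m ⟧ → x ∈ ⟦ P ^ᵢ m ⟧ →
                  ∀ e → x ∈ ⟦ ⟨ π ⟩ +ᵢ P ^ᵢ e ⟧
      generated m {π} {x} π∈ π∉ x∈ e =
        let u , eu = divide-^ m π∈
            v , ev = divide-^ m x∈
            u∉P : u ∉ ⟦ P ⟧
            u∉P u∈P = π∉ (∈^-cancelˡ (suc m) (^∉P m y∉P)
              (∈-resp (P ^ᵢ suc m) eu (·ᵢ-in {I = P} {J = P ^ᵢ m} u∈P (p^∈ m))))
            t , 1-tu∈ = inverse-mod-^ u∉P e
            ux≈vπ = *-cancelˡ (y ^ m) (^≉0 m (∉P⇒≉0 y∉P)) (begin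
              y ^ m * (u * x)    ≈⟨ solve 3 (λ y u x → y :* (u :* x) := u :* (y :* x)) refl (y ^ m) u x ⟩
              u * (y ^ m * x)    ≈⟨ *-congˡ ev ⟩
              u * (v * p ^ m)    ≈⟨ solve 3 (λ u v w → u :* (v :* w) := v :* (u :* w)) refl u v (p ^ m) ⟩
              v * (u * p ^ m)    ≈⟨ *-congˡ eu ⟨
              v * (y ^ m * π)    ≈⟨ solve 3 (λ v y π → v :* (y :* π) := y :* (v :* π)) refl v (y ^ m) π ⟩
              y ^ m * (v * π)    ∎)
        in (t * v) * π , (1# - t * u) * x , *∈⟨⟩ (t * v) π , ∈-*ʳ (P ^ᵢ e) 1-tu∈ , (begin
          x                                 ≈⟨ solve 3 (λ t u x → x := t :* (u :* x) :+ (con 1ℤ :- t :* u) :* x) refl t u x ⟩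
          t * (u * x) + (1# - t * u) * x    ≈⟨ +-congʳ (trans (*-congˡ ux≈vπ) (sym (*-assoc _ _ _))) ⟩
          (t * v) * π + (1# - t * u) * x    ∎)

    ^ᵢ⊆⟨⟩+^ᵢ : ∀ m {π} → π ∈ ⟦ P ^ᵢ m ⟧ → π ∉ ⟦ P ^ᵢ suc m ⟧ → ∀ e → P ^ᵢ m ⊆ᵢ ⟨ π ⟩ +ᵢ P ^ᵢ e
    ^ᵢ⊆⟨⟩+^ᵢ m π∈ π∉ e x∈ =
      let p , y , p∈P , y∉P , divide = uniformiser
      in generated p y p∈P y∉P divide m π∈ π∉ x∈ e

-- The quotient R = D/K, powers of its primes, and the valuations w.

minimiser : ∀ {n} (f : Fin n → ℕ) → Fin n → ∃[ i ] (∀ j → f i ℕ.≤ f j)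
minimiser {n} f i = argmin f i (allFin n) , λ j → All.lookup (f[argmin]≤f[xs] i (allFin n)) (∈-allFin j)

greatestBelow : ∀ {p} {Q : ℕ → Set p} → (∀ m → Dec (Q m)) → Q 0 → ∀ e →
                ∃[ ρ ] ρ ℕ.≤ e × Q ρ × (∀ {m} → m ℕ.≤ e → Q m → m ℕ.≤ ρ)
greatestBelow Q? q₀ zero = 0 , z≤n , q₀ , λ m≤0 _ → m≤0
greatestBelow {Q = Q} Q? q₀ (suc e) with Q? (suc e) | greatestBelow Q? q₀ e
... | yes q | _                     = suc e , ℕ.≤-refl , q , λ m≤ _ → m≤
... | no ¬q | ρ , ρ≤e , qρ , max = ρ , ℕ.m≤n⇒m≤1+n ρ≤e , qρ , λ m≤1+e qm →
      max (ℕ.≤-pred (ℕ.≤∧≢⇒< m≤1+e λ m≡ → ¬q (≡.subst Q m≡ qm))) qm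

module PrimaryComponents {c ℓ : Level} (D : CommutativeRing c ℓ) (dedekind : Ideals.IsDedekindDomain D)
            (fnp : Ideals.FiniteNormProperty D) (S : Setting D) where
  open CommutativeRing D hiding (zero)
  open Ideals D
  open IdealProperties D
  open IsDedekindDomain dedekind
  open Setting S

  R : CommutativeRing c (c ⊔ ℓ)
  R = Quotient K

  module R  = CommutativeRing R
  module RI = Ideals R
  module RP = IdealProperties R

  em : (A : Set (c ⊔ ℓ)) → Dec A
  em = excludedMiddle D fnp J J≠0 J≠D

  A : Fin n → Ideal
  A l = P l ^ᵢ e l

  K⊆J : K ⊆ᵢ J
  K⊆J = proj₂

  K⊆I : ∀ i → K ⊆ᵢ I i
  K⊆I i = go I i ∘ proj₁
    where
      go : ∀ {r} (I : Vector Ideal r) i → ⋂ᵢ I ⊆ᵢ I i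
      go I zero    = proj₁
      go I (suc i) = go (tail I) i ∘ proj₂

  K⊆A : ∀ l → K ⊆ᵢ A l
  K⊆A l = ∏ᵢ⊆ A l ∘ proj₁ K-factorise

  ∏A⊆K : ∏ᵢ A ⊆ᵢ K
  ∏A⊆K = proj₂ K-factorise

  1∉K : 1# ∉ ⟦ K ⟧
  1∉K 1∈K = J≠D (1∈⇒≐1 J (K⊆J 1∈K))

  P-max : ∀ l → IsMaximalIdeal (P l)
  P-max l = primesMaximal (P l) (P-prime l) (P≠0 l)

  module Local (l : Fin n) = LocalPrime D isIntegralDomain integrallyClosed fnp em (P l) (P-prime l) (P≠0 l) (P-max l)

  P-comaximal : ∀ {l m} → l ≢ m → Comaximal (P l) (P m)
  P-comaximal {l} {m} l≢m =
    let s , s∈Pl , s∉Pm = separated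
    in comaximal-mono {I = ⟨ s ⟩} {I′ = P l} {J = P m} {J′ = P m} (⟨⟩-least (P l) s∈Pl) id (Local.∉P⇒comaximal m s∉Pm)
    where
      separated : ∃[ s ] s ∈ ⟦ P l ⟧ × s ∉ ⟦ P m ⟧
      separated = decidable-stable (em _) λ ¬∃ →
        let Pl⊆Pm : P l ⊆ᵢ P m
            Pl⊆Pm {x} x∈ = decidable-stable (em _) λ x∉ → ¬∃ (x , x∈ , x∉)
        in IsPrimeIdeal.proper (P-prime m) (IsMaximalIdeal.maximal (P-max l) (P m)
             (Pl⊆Pm , λ Pm⊆Pl → l≢m (P-distinct ((λ {x} → Pl⊆Pm {x}) , λ {x} → Pm⊆Pl {x}))))

  A-comaximal : PairwiseComaximal A
  A-comaximal {l} {m} l≢m = comaximal-^^ (P l) (P m) (P-comaximal l≢m) (e l) (e m)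

  -- The powers of P̄_l are constant from e_l on. Away from l this is checked locally: P_l^m is
  -- comaximal with every other A_l′, so the sum is everything there.
  stabilise : ∀ l m → A l ⊆ᵢ P l ^ᵢ m +ᵢ K
  stabilise l m {z} z∈A = local-global A A-comaximal L (+ᵢ-inʳ (P l ^ᵢ m) K ∘ ∏A⊆K) at
    where
      L = P l ^ᵢ m +ᵢ K
      at : ∀ l′ → z ∈ ⟦ L +ᵢ A l′ ⟧
      at l′ = case l Fin.≟ l′ of λ where
        (yes ≡.refl) → +ᵢ-inʳ L (A l) z∈A
        (no l≢l′)    → comaximal⇒∈+ {I = L} {J = A l′} (comaximal-mono {I = P l ^ᵢ m} {I′ = L} {J = A l′} {J′ = A l′}
          (+ᵢ-inˡ (P l ^ᵢ m) K) id (comaximal-^^ (P l) (P l′) (P-comaximal l≢l′) m (e l′))) z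

  ι : Ideal → RI.Ideal
  ι = reduce D K

  -- Pullback along D → R. The quotient shares the carrier of D, so the members stay the same.
  κ : RI.Ideal → Ideal
  κ V = record
    { members  = RI.⟦ V ⟧
    ; respects = λ x≈y → RI.Ideal.respects V (≈⇒≈[] K x≈y)
    ; 0∈       = RI.Ideal.0∈ V
    ; +-closed = RI.Ideal.+-closed V
    ; *-closed = RI.Ideal.*-closed V
    }

  K⊆κ : ∀ V → K ⊆ᵢ κ V
  K⊆κ V k∈K = RI.Ideal.respects V (R.sym (∈⇒≈[]0 K k∈K)) (RI.Ideal.0∈ V)

  ι-in : ∀ {I x} → x ∈ ⟦ I ⟧ → x ∈ RI.⟦ ι I ⟧
  ι-in x∈I = _ , x∈I , R.refl

  ι-out : ∀ I {x} → K ⊆ᵢ I → x ∈ RI.⟦ ι I ⟧ → x ∈ ⟦ I ⟧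
  ι-out I K⊆I (y , y∈I , x∼y) = ∈-resp-≈[] I (K⊆I x∼y) y∈I

  ι^⊆ : ∀ I m → ι I RI.^ᵢ m RI.⊆ᵢ ι (I ^ᵢ m)
  ι^⊆ I zero    _ = _ , tt , R.refl
  ι^⊆ I (suc m) = RP.·ᵢ-least {I = ι I} {J = ι I RI.^ᵢ m} (ι (I ^ᵢ suc m)) λ p q → mul p (ι^⊆ I m q)
    where
      mul : ∀ {x y} → x ∈ RI.⟦ ι I ⟧ → y ∈ RI.⟦ ι (I ^ᵢ m) ⟧ → x * y ∈ RI.⟦ ι (I ^ᵢ suc m) ⟧
      mul (x′ , x′∈ , x∼) (y′ , y′∈ , y∼) = x′ * y′ , ·ᵢ-in {I = I} {J = I ^ᵢ m} x′∈ y′∈ , R.*-cong x∼ y∼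

  ^⊆ι^ : ∀ I m → I ^ᵢ m ⊆ᵢ κ (ι I RI.^ᵢ m)
  ^⊆ι^ I zero    _ = tt
  ^⊆ι^ I (suc m) = ·ᵢ-least {I = I} {J = I ^ᵢ m} (κ (ι I RI.^ᵢ suc m)) λ p q →
    RP.·ᵢ-in {I = ι I} {J = ι I RI.^ᵢ m} (ι-in {I} p) (^⊆ι^ I m q)

  module Valuation (l : Fin n) where

    𝔓 : RI.Ideal
    𝔓 = ι (P l)

    -- The bound ensures K ⊆ P_l^m, so that nothing is added by passing to R and back. Beyond e_l
    -- the power of 𝔓 pulls back to A_l, one inclusion of which is `A⊆𝔓^`.
    𝔓^-out : ∀ {m x} → m ℕ.≤ e l → x ∈ RI.⟦ 𝔓 RI.^ᵢ m ⟧ → x ∈ ⟦ P l ^ᵢ m ⟧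
    𝔓^-out {m} m≤e x∈ = ι-out (P l ^ᵢ m) (^ᵢ-antitone (P l) m≤e ∘ K⊆A l) (ι^⊆ (P l) m x∈)

    A⊆𝔓^ : ∀ m → A l ⊆ᵢ κ (𝔓 RI.^ᵢ m)
    A⊆𝔓^ m = +ᵢ-least {I = P l ^ᵢ m} {J = K} (κ (𝔓 RI.^ᵢ m)) (^⊆ι^ (P l) m) (K⊆κ (𝔓 RI.^ᵢ m)) ∘ stabilise l m

    isW-member : ∀ {a V} → RI.IsW 𝔓 a V → a ∈ RI.⟦ V ⟧
    isW-member (inj₁ (a≈0 , V≐0))          = proj₂ V≐0 (lift a≈0)
    isW-member (inj₂ (_ , m , V≐ , a∈ , _)) = proj₂ V≐ a∈

    isW-cong : ∀ {a a′ V} → a R.≈ a′ → RI.IsW 𝔓 a V → RI.IsW 𝔓 a′ V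
    isW-cong a≈a′ (inj₁ (a≈0 , V≐0)) = inj₁ (R.trans (R.sym a≈a′) a≈0 , V≐0)
    isW-cong a≈a′ (inj₂ (a≉0 , m , V≐ , a∈ , min)) =
      inj₂ (a≉0 ∘ R.trans a≈a′ , m , V≐ , RI.Ideal.respects (𝔓 RI.^ᵢ m) a≈a′ a∈ ,
            λ m′ a′∈ → min m′ (RI.Ideal.respects (𝔓 RI.^ᵢ m′) (R.sym a≈a′) a′∈))

    -- Local principality enters here. If a ∈ A_l, then V is at most the stable power; otherwise V
    -- comes from P_l^m with m < e_l and a ∉ P_l^(m+1), so a generates P_l^m modulo A_l.
    isW-bound : ∀ {a V} → RI.IsW 𝔓 a V → ∀ {z} → z ∈ RI.⟦ V ⟧ → z ∈ ⟦ ⟨ a ⟩ +ᵢ A l ⟧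
    isW-bound {a} (inj₁ (_ , V≐0)) z∈V = +ᵢ-inʳ ⟨ a ⟩ (A l) (K⊆A l (≈[]0⇒∈ K (lower (proj₁ V≐0 z∈V))))
    isW-bound {a} {V} (inj₂ (_ , m , V≐ , a∈𝔓^m , min)) {z} z∈V = case em (a ∈ ⟦ A l ⟧) of λ where
        (yes a∈A) → +ᵢ-inʳ ⟨ a ⟩ (A l) (𝔓^-out ℕ.≤-refl (min (e l) (^⊆ι^ (P l) (e l) a∈A) (proj₁ V≐ z∈V)))
        (no a∉A)  → case ℕ.<-≤-connex m (e l) of λ where
          (inj₂ e≤m) → contradiction (𝔓^-out ℕ.≤-refl (RP.^ᵢ-antitone 𝔓 e≤m a∈𝔓^m)) a∉A
          (inj₁ m<e) → Local.^ᵢ⊆⟨⟩+^ᵢ l m (𝔓^-out (ℕ.<⇒≤ m<e) a∈𝔓^m) (a∉P^1+m a∉A m<e) (e l)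
                         (𝔓^-out (ℕ.<⇒≤ m<e) (proj₁ V≐ z∈V))
      where
        -- Were a in P_l^(m+1), minimality of V would give P_l^m ⊆ P_l^(m+1). Multiplying repeatedly
        -- by P_l yields P_l^m ⊆ A_l, against a ∉ A_l.
        descend : P l ^ᵢ m ⊆ᵢ P l ^ᵢ suc m → ∀ d → P l ^ᵢ m ⊆ᵢ P l ^ᵢ (d ℕ.+ m)
        descend step zero    = id
        descend step (suc d) = ·ᵢ-mono {I = P l} {I′ = P l} {J = P l ^ᵢ m} {J′ = P l ^ᵢ (d ℕ.+ m)} id (descend step d) ∘ step

        a∉P^1+m : a ∉ ⟦ A l ⟧ → m ℕ.< e l → a ∉ ⟦ P l ^ᵢ suc m ⟧
        a∉P^1+m a∉A m<e a∈ = a∉A (≡.subst (λ k → a ∈ ⟦ P l ^ᵢ k ⟧) (ℕ.m∸n+n≡m (ℕ.<⇒≤ m<e))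
          (descend (λ y∈ → 𝔓^-out m<e (min (suc m) (^⊆ι^ (P l) (suc m) a∈) (^⊆ι^ (P l) m y∈))) (e l ∸ m)
            (^ᵢ-antitone (P l) (ℕ.n≤1+n m) a∈)))

    -- Larger rank means smaller w; the rank of 0 exceeds all others as w(0) = 0.
    Rank : Carrier → ℕ → Set (c ⊔ ℓ)
    Rank a ρ = (a ∈ ⟦ K ⟧ × ρ ≡ suc (e l))
             ⊎ (a ∉ ⟦ K ⟧ × ρ ℕ.≤ e l × a ∈ ⟦ P l ^ᵢ ρ ⟧ × (∀ {m} → m ℕ.≤ e l → a ∈ ⟦ P l ^ᵢ m ⟧ → m ℕ.≤ ρ))

    rank : ∀ a → ∃[ ρ ] Rank a ρ
    rank a = case em (a ∈ ⟦ K ⟧) of λ where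
      (yes a∈K) → suc (e l) , inj₁ (a∈K , ≡.refl)
      (no a∉K)  → let ρ , ρ≤e , a∈ , max = greatestBelow (λ m → em (a ∈ ⟦ P l ^ᵢ m ⟧)) tt (e l)
                  in ρ , inj₂ (a∉K , ρ≤e , a∈ , λ {m} → max {m})

    rank-least : ∀ {a ρ} → ρ ℕ.≤ e l → (∀ {m} → m ℕ.≤ e l → a ∈ ⟦ P l ^ᵢ m ⟧ → m ℕ.≤ ρ) →
                 ∀ m → a ∈ RI.⟦ 𝔓 RI.^ᵢ m ⟧ → 𝔓 RI.^ᵢ ρ RI.⊆ᵢ 𝔓 RI.^ᵢ m
    rank-least {a} {ρ} ρ≤e max m a∈ = case ℕ.≤-total m (e l) of λ where
      (inj₁ m≤e) → RP.^ᵢ-antitone 𝔓 (max m≤e (𝔓^-out m≤e a∈))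
      -- Here a ∈ A_l, so e_l ≤ ρ and the ρ-th power is already the stable one.
      (inj₂ e≤m) → λ x∈ → A⊆𝔓^ m (𝔓^-out ℕ.≤-refl (RP.^ᵢ-antitone 𝔓
                     (max ℕ.≤-refl (𝔓^-out ℕ.≤-refl (RP.^ᵢ-antitone 𝔓 e≤m a∈))) x∈))

    ∉K⇒≉0 : ∀ {a} → a ∉ ⟦ K ⟧ → ¬ (a R.≈ R.0#)
    ∉K⇒≉0 a∉K = a∉K ∘ ≈[]0⇒∈ K

    isW-exists : ∀ a → ∃[ V ] RI.IsW 𝔓 a V
    isW-exists a = fromRank (rank a)
      where
        fromRank : ∃[ ρ ] Rank a ρ → ∃[ V ] RI.IsW 𝔓 a V
        fromRank (_ , inj₁ (a∈K , _)) = RI.0ᵢ , inj₁ (∈⇒≈[]0 K a∈K , (λ x → x) , (λ x → x))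
        fromRank (ρ , inj₂ (a∉K , ρ≤e , a∈ , max)) = 𝔓 RI.^ᵢ ρ ,
          inj₂ (∉K⇒≉0 a∉K , ρ , ((λ x → x) , (λ x → x)) , ^⊆ι^ (P l) ρ a∈ , rank-least ρ≤e max)

    isW-0 : ∀ {a V} → a ∈ ⟦ K ⟧ → RI.IsW 𝔓 a V → V RI.≐ᵢ RI.0ᵢ
    isW-0 a∈K (inj₁ (_ , V≐0)) = V≐0
    isW-0 a∈K (inj₂ (a≉0 , _)) = contradiction (∈⇒≈[]0 K a∈K) a≉0

    rank-antitone : ∀ {a a′ ρ ρ′ V V′} → Rank a ρ → Rank a′ ρ′ → ρ′ ℕ.≤ ρ →
                    RI.IsW 𝔓 a V → RI.IsW 𝔓 a′ V′ → V RI.⊆ᵢ V′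
    rank-antitone {a} {V = V} {V′ = V′} (inj₁ (a∈K , _)) _ _ w _ x∈V =
      K⊆κ V′ (≈[]0⇒∈ K (lower (proj₁ (isW-0 {a} {V} a∈K w) x∈V)))
    rank-antitone (inj₂ (_ , ρ≤e , _)) (inj₁ (_ , ≡.refl)) ρ′≤ρ = contradiction (ℕ.≤-trans ρ′≤ρ ρ≤e) ℕ.1+n≰n
    rank-antitone (inj₂ (a∉K , _)) (inj₂ _) _ (inj₁ (a≈0 , _)) _ = contradiction a≈0 (∉K⇒≉0 a∉K)
    rank-antitone (inj₂ _) (inj₂ (a′∉K , _)) _ _ (inj₁ (a′≈0 , _)) = contradiction a′≈0 (∉K⇒≉0 a′∉K)
    rank-antitone {ρ = ρ} (inj₂ (_ , ρ≤e , a∈ , _)) (inj₂ (_ , ρ′≤e , _ , max′)) ρ′≤ρ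
                  (inj₂ (_ , m , V≐ , _ , min)) (inj₂ (_ , m′ , V′≐ , a′∈ , _)) x∈V =
      proj₂ V′≐ (rank-least ρ′≤e max′ m′ a′∈ (RP.^ᵢ-antitone 𝔓 ρ′≤ρ (min ρ (^⊆ι^ (P l) ρ a∈) (proj₁ V≐ x∈V))))

-- Existence of orderings, glued nodes, and generators of v_k.

least : ∀ {p} {Q : ℕ → Set p} → (∀ m → Dec (Q m)) → ∀ N → Q N →
        ∃[ m ] Q m × (∀ {k} → k ℕ.< m → ¬ Q k)
least Q? zero    qN = 0 , qN , λ ()
least {Q = Q} Q? (suc N) qN with Q? 0 | least (Q? ∘ suc) N qN
... | yes q₀ | _            = 0 , q₀ , λ ()
... | no ¬q₀ | m , qm , min = suc m , qm , λ { {zero} _ → ¬q₀ ; {suc k} (s≤s k<m) → min k<m }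

module Orderings {c ℓ : Level} (D : CommutativeRing c ℓ) (dedekind : Ideals.IsDedekindDomain D)
                 (fnp : Ideals.FiniteNormProperty D) (S : Setting D) where
  open CommutativeRing D hiding (zero)
  open Ideals D
  open IdealProperties D
  open Newton D
  open Setting S
  open PrimaryComponents D dedekind fnp S
  open IntegerSolver D using (solve; con; _:+_; _:*_; _:-_; :-_; _:=_)

  module _ (i : Fin r) where

    finite-I : ∃[ n ] HasCardinality (Mod.setoid (I i)) n
    finite-I = fnp (I i) (I≠0 i)

    N : ℕ
    N = proj₁ finite-I

    open Residues D (I i) (proj₂ finite-I)
    open IsCompleteResidueSystem (𝒟-residue i)

    element : Fin N → Carrier
    element t = proj₁ (represents (rep t))

    element∈𝒟 : ∀ t → element t ∈ 𝒟 i
    element∈𝒟 t = proj₁ (proj₂ (represents (rep t)))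

    ≈element : ∀ {d} → d ∈ 𝒟 i → d ≈ element (index d)
    ≈element {d} d∈𝒟 = unique d∈𝒟 (element∈𝒟 (index d))
      (Mod.trans (I i) (≈rep d) (proj₂ (proj₂ (represents (rep (index d))))))

    module _ (l : Fin n) where
      open Valuation l

      pick : (Carrier → Carrier) → Carrier
      pick h = element (proj₁ (minimiser (λ t → proj₁ (rank (h (element t)))) (index 0#)))

      pick-minimal : ∀ (h : Carrier → Carrier) t → proj₁ (rank (h (pick h))) ℕ.≤ proj₁ (rank (h (element t)))
      pick-minimal h = proj₂ (minimiser (λ t → proj₁ (rank (h (element t)))) (index 0#))

      -- Greedy choice of an ordering. Carrying the polynomial function built so far, rather than
      -- the list of earlier terms, makes the recursion structural; the sequence `β` is read off
      -- afterwards.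
      newtons : ℕ → Carrier → Carrier
      newtons zero    x = 1#
      newtons (suc k) x = newtons k x * (x - pick (newtons k))

      β : ℕ → Carrier
      β k = pick (newtons k)

      newtons≡ : ∀ k x → newtons k x ≡ newton β k x
      newtons≡ zero    x = ≡.refl
      newtons≡ (suc k) x = ≡.cong (_* (x - β k)) (newtons≡ k x)

      differences≈newtons : ∀ k x → differences β k x ≈ newtons k x
      differences≈newtons k x = trans (differences≈newton β k x) (reflexive (≡.sym (newtons≡ k x)))

      β-ordering : RI.IsOrdering 𝔓 (X S i) β
      β-ordering = record
        { inside  = λ k → β k , element∈𝒟 _ , R.refl
        ; largest = λ k _ {x} (d , d∈𝒟 , x∼d) {V} {W} w w′ →
            let t = index d
                x∼t : x R.≈ element t
                x∼t = R.trans x∼d (≈⇒≈[] K (≈element d∈𝒟))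
                x-to-t : differences β k x R.≈ newtons k (element t)
                x-to-t = R.trans (≈⇒≈[] K (differences≈newton β k x))
                  (R.trans (newton-≈[] K (λ _ → R.refl) k x∼t) (R.reflexive (≡.sym (newtons≡ k (element t)))))
            in rank-antitone {V = V} {V′ = W}
                 (proj₂ (rank (newtons k (element t)))) (proj₂ (rank (newtons k (β k))))
                 (pick-minimal (newtons k) t)
                 (isW-cong {V = V} x-to-t w)
                 (isW-cong {V = W} (≈⇒≈[] K (differences≈newtons k (β k))) w′)
        }

    -- `IsV` provides no sequence at k = 0. This record treats all k alike, with `β` and the empty
    -- product 1 standing in there.
    record OrderingAt (l : Fin n) (k : ℕ) (V : RI.Ideal) : Set (lsuc (c ⊔ ℓ)) where
      constructor orderingAt
      field
        b        : ℕ → Carrier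
        ordering : RI.IsOrdering (Valuation.𝔓 l) (X S i) b
        isW      : RI.IsW (Valuation.𝔓 l) (pivot b k) V

    module _ (l : Fin n) where
      open Valuation l

      isV⇒ordering : ∀ k V → RI.IsV 𝔓 (X S i) k V → OrderingAt l k V
      isV⇒ordering zero    V (lift V≐1) = orderingAt (β l) (β-ordering l)
        (inj₂ (∉K⇒≉0 1∉K , 0 , V≐1 , tt , λ m′ 1∈ {x} _ → RI.Ideal.respects (𝔓 RI.^ᵢ m′) (R.*-identityʳ x)
          (RI.Ideal.*-closed (𝔓 RI.^ᵢ m′) x 1∈)))
      isV⇒ordering (suc k) V (b , ord , w) = orderingAt b ord
        (isW-cong {V = V} (≈⇒≈[] K (differences≈newton b (suc k) (b (suc k)))) w)

      isV-exists : ∀ k → ∃[ V ] RI.IsV 𝔓 (X S i) k V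
      isV-exists zero    = RI.1ᵢ , lift ((λ x → x) , (λ x → x))
      isV-exists (suc k) = let V , w = isW-exists (differences (β l) (suc k) (β l (suc k)))
                           in V , β l , β-ordering l , w

      𝒟⊆X : ∀ {x} → x ∈ 𝒟 i → x ∈ X S i
      𝒟⊆X x∈𝒟 = _ , x∈𝒟 , R.refl

      largest-newton : ∀ {b} → RI.IsOrdering 𝔓 (X S i) b → ∀ k {x} → x ∈ 𝒟 i → ∀ {V W} →
                       RI.IsW 𝔓 (newton b (suc k) x) V → RI.IsW 𝔓 (pivot b (suc k)) W → V RI.⊆ᵢ W
      largest-newton {b} ord k x∈𝒟 {V} {W} w w′ = RI.IsOrdering.largest ord (suc k) (s≤s z≤n) (𝒟⊆X x∈𝒟) {V} {W}
        (isW-cong {V = V} (≈⇒≈[] K (sym (differences≈newton b (suc k) _))) w)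
        (isW-cong {V = W} (≈⇒≈[] K (sym (differences≈newton b (suc k) _))) w′)

      -- N_k(x) lies in its own w, which the maximality of the ordering places inside w of the
      -- pivot, and `isW-bound` turns that into divisibility modulo A_l.
      ordering⇒adapted : ∀ {b} → RI.IsOrdering 𝔓 (X S i) b → Adapted (A l) (𝒟 i) b
      ordering⇒adapted {b} ord = record
        { near    = λ k → let d , d∈𝒟 , b∼d = RI.IsOrdering.inside ord k in d , d∈𝒟 , K⊆A l b∼d
        ; divides = divides
        }
        where
          divides : ∀ k {x} → x ∈ 𝒟 i → newton b k x ∈ ⟦ ⟨ pivot b k ⟩ +ᵢ A l ⟧
          divides zero    x∈𝒟 = +ᵢ-inˡ ⟨ 1# ⟩ (A l) (∈⟨⟩ 1#)
          divides (suc k) {x} x∈𝒟 =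
            let V , v = isW-exists (newton b (suc k) x)
                W , w = isW-exists (pivot b (suc k))
            in isW-bound {V = W} w (largest-newton ord k x∈𝒟 {V} {W} v w (isW-member {V = V} v))

      -- With w(0) = 0 as the largest value, every competing w is 0 as well. The conclusion is
      -- modulo K, hence reaches the other primes too.
      pivot-zero : ∀ {b} → RI.IsOrdering 𝔓 (X S i) b → ∀ k → pivot b k ∈ ⟦ K ⟧ → ∀ {x} → x ∈ 𝒟 i → newton b k x ∈ ⟦ K ⟧
      pivot-zero ord zero    π∈K x∈𝒟 = contradiction π∈K 1∉K
      pivot-zero {b} ord (suc k) π∈K {x} x∈𝒟 =
        let V , v = isW-exists (newton b (suc k) x)
        in ≈[]0⇒∈ K (lower (largest-newton ord k x∈𝒟 {V} {RI.0ᵢ} v (inj₁ (∈⇒≈[]0 K π∈K , (λ x → x) , (λ x → x)))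
                     (isW-member {V = V} v)))

    private
      glued : ∀ k → ∃[ z ] (∀ l → z ≈[ A l ] β l k)
      glued k = chineseRemainder A A-comaximal (λ l → β l k)

    nodes : ℕ → Carrier
    nodes k = proj₁ (glued k)

    nodes-adapted : ∀ l → Adapted (A l) (𝒟 i) nodes
    nodes-adapted l = adapted-≈[] (A l) (λ k → proj₂ (glued k) l) (ordering⇒adapted l (β-ordering l))

    private
      local : ∀ J′ → K ⊆ᵢ J′ → ∀ {x} → (∀ l → x ∈ ⟦ J′ +ᵢ A l ⟧) → x ∈ ⟦ J′ ⟧
      local J′ K⊆J′ = local-global A A-comaximal J′ (K⊆J′ ∘ ∏A⊆K)

    module _ (k : ℕ) (V : Fin n → RI.Ideal) (V-isV : ∀ l → RI.IsV (Valuation.𝔓 l) (X S i) k (V l)) where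
      private
        π : Carrier
        π = pivot nodes k

        ord : ∀ l → OrderingAt l k (V l)
        ord l = isV⇒ordering l k (V l) (V-isV l)

        a : Fin n → Carrier
        a l = pivot (OrderingAt.b (ord l)) k

        adapted : ∀ l → Adapted (A l) (𝒟 i) (OrderingAt.b (ord l))
        adapted l = ordering⇒adapted l (OrderingAt.ordering (ord l))

        V⊆ : ∀ l {z} → z ∈ RI.⟦ V l ⟧ → z ∈ ⟦ ⟨ π ⟩ +ᵢ A l ⟧
        V⊆ l {z} z∈V = +ᵢ-least {I = ⟨ a l ⟩} {J = A l} Z (⟨⟩-least Z (pivot-unique (A l) (adapted l) (nodes-adapted l) k))
            (+ᵢ-inʳ ⟨ π ⟩ (A l)) (Valuation.isW-bound l {V = V l} (OrderingAt.isW (ord l)) z∈V)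
          where Z = ⟨ π ⟩ +ᵢ A l

        π∈⟨a⟩ : ∀ l → π ∈ ⟦ ⟨ a l ⟩ +ᵢ A l ⟧
        π∈⟨a⟩ l = pivot-unique (A l) (nodes-adapted l) (adapted l) k

      -- The product lies in each V_l, which `pivot-unique` bounds by ⟨π⟩ modulo A_l; `local-global`
      -- combines these bounds modulo K.
      ∏V⊆⟨pivot⟩ : RI.∏ᵢ V RI.⊆ᵢ RP.⟨ π ⟩
      ∏V⊆⟨pivot⟩ {z} z∈∏V = toR (local L (+ᵢ-inʳ ⟨ π ⟩ K) λ l →
          +ᵢ-mono {I = ⟨ π ⟩} {I′ = L} {J = A l} {J′ = A l} (+ᵢ-inˡ ⟨ π ⟩ K) id (V⊆ l (RP.∏ᵢ⊆ V l z∈∏V)))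
        where
          L = ⟨ π ⟩ +ᵢ K
          toR : z ∈ ⟦ L ⟧ → z ∈ RI.⟦ RP.⟨ π ⟩ ⟧
          toR (u , k , lift (t , u≈tπ) , k∈K , z≈u+k) = lift (t , ∈-resp K
            (trans (+-congʳ (trans z≈u+k (+-congʳ u≈tπ))) (solve 2 (λ x k → (x :+ k) :- x := k) refl (t * π) k)) k∈K)

      pivot∈∏V : π ∈ RI.⟦ RI.∏ᵢ V ⟧
      pivot∈∏V = case em (∃[ l ] a l ∈ ⟦ K ⟧) of λ where
          -- One factor is w(0) = 0, so π must vanish in R. The polynomial of this single ordering
          -- is zero on 𝒟 modulo K, hence modulo every A_l′, and minimality of π applies at each l′.
          (yes (l , a∈K)) → K⊆κ (RI.∏ᵢ V) (∏A⊆K (∈-∏ᵢ-comaximal A A-comaximal λ l′ →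
            pivot-minimal (A l′) (nodes-adapted l′) (OrderingAt.b (ord l)) k λ x∈𝒟 →
              K⊆A l′ (pivot-zero l (OrderingAt.ordering (ord l)) k a∈K x∈𝒟)))
          -- All V_l are now powers of distinct primes, hence pairwise comaximal, and it is enough
          -- that π lies in each of them.
          (no ¬a∈K) → RP.∈-∏ᵢ-comaximal V
            (λ {l} {m} l≢m → V-comaximal l≢m (power l (λ p → ¬a∈K (l , p))) (power m (λ p → ¬a∈K (m , p))))
            (λ l → π∈V l (power l λ p → ¬a∈K (l , p)))
        where
          Power : Fin n → Set (c ⊔ ℓ)
          Power l = ∃[ m ] V l RI.≐ᵢ Valuation.𝔓 l RI.^ᵢ m

          power : ∀ l → a l ∉ ⟦ K ⟧ → Power l
          power l a∉K = case OrderingAt.isW (ord l) of λ where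
            (inj₁ (a≈0 , _))    → contradiction a≈0 (Valuation.∉K⇒≉0 l a∉K)
            (inj₂ (_ , m , V≐ , _)) → m , V≐

          π∈V : ∀ l → Power l → π ∈ RI.⟦ V l ⟧
          π∈V l (m , V≐) = +ᵢ-least {I = ⟨ a l ⟩} {J = A l} (κ (V l))
            (⟨⟩-least (κ (V l)) (Valuation.isW-member l {V = V l} (OrderingAt.isW (ord l))))
            (λ x∈A → proj₂ V≐ (Valuation.A⊆𝔓^ l m x∈A)) (π∈⟨a⟩ l)

          V-comaximal : ∀ {l m} → l ≢ m → Power l → Power m → RP.Comaximal (V l) (V m)
          V-comaximal {l} {m} l≢m (j , V≐) (j′ , V′≐) =
            let s , s∈ , 1-s∈ = comaximal-^^ (P l) (P m) (P-comaximal l≢m) j j′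
            in s , proj₂ V≐ (^⊆ι^ (P l) j s∈) , proj₂ V′≐ (^⊆ι^ (P m) j′ 1-s∈)

    newton-divides : ∀ k {x} → x ∈ 𝒟 i → newton nodes k x ∈ ⟦ ⟨ pivot nodes k ⟩ +ᵢ J ⟧
    newton-divides k x∈𝒟 = local L (+ᵢ-inʳ ⟨ π ⟩ J ∘ K⊆J) λ l →
        +ᵢ-mono {I = ⟨ π ⟩} {I′ = L} {J = A l} {J′ = A l} (+ᵢ-inˡ ⟨ π ⟩ J) id (Adapted.divides (nodes-adapted l) k x∈𝒟)
      where
        π = pivot nodes k
        L = ⟨ π ⟩ +ᵢ J

    -- The nodes are adapted to each A_l, hence to the larger `J +ᵢ A l`. Triangularity holds there,
    -- and `local-global` returns to J.
    newton-independent : ∀ a m → (∀ {x} → x ∈ 𝒟 i → expand nodes a m x ∈ ⟦ J ⟧) →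
                         ∀ {t} → t ℕ.< m → a t * pivot nodes t ∈ ⟦ J ⟧
    newton-independent a m null t<m = local J K⊆J λ l → coefficients-vanish (J +ᵢ A l)
      (adapted-mono (A l) (J +ᵢ A l) (+ᵢ-inʳ J (A l)) (nodes-adapted l)) a m (λ x∈𝒟 → +ᵢ-inˡ J (A l) (null x∈𝒟)) t<m

    -- The Newton polynomial on a list of all representatives, padded by `0#`, vanishes on 𝒟, so
    -- minimality applies. The index `suc N` fits the search in `μ-exists`, which runs over k
    -- through the positive index `suc k`.
    pivot-N∈K : pivot nodes (suc N) ∈ ⟦ K ⟧
    pivot-N∈K = ∏A⊆K (∈-∏ᵢ-comaximal A A-comaximal λ l → pivot-minimal (A l) (nodes-adapted l) enumeration (suc N)
        λ {x} x∈𝒟 → ∈-resp (A l)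
          (trans (newton-cong enumeration (suc N)
                   (trans (≈element x∈𝒟) (reflexive (≡.sym (enumeration-toℕ (index x))))))
          (newton-node enumeration (ℕ.m<n⇒m<1+n (Fin.toℕ<n (index x))))) (Ideal.0∈ (A l)))
      where
        enumeration : ℕ → Carrier
        enumeration k = case k ℕ.<? N of λ where
          (yes k<N) → element (Fin.fromℕ< k<N)
          (no _)    → 0#

        enumeration-toℕ : ∀ t → enumeration (toℕ t) ≡ element t
        enumeration-toℕ t with toℕ t ℕ.<? N
        ... | yes p = ≡.cong element (Fin.fromℕ<-toℕ t p)
        ... | no ¬p = contradiction (Fin.toℕ<n t) ¬p

    module _ (V : ℕ → Fin n → RI.Ideal) (V-isV : ∀ k l → RI.IsV (Valuation.𝔓 l) (X S i) k (V k l)) where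

      ∏V⊆J⇒pivot∈J : ∀ k → RI.∏ᵢ (V k) RI.⊆ᵢ ι J → pivot nodes k ∈ ⟦ J ⟧
      ∏V⊆J⇒pivot∈J k V⊆J = ι-out J K⊆J (V⊆J (pivot∈∏V k (V k) (V-isV k)))

      μ-exists : ∃[ m ] 1 ℕ.≤ m × RI.∏ᵢ (V m) RI.⊆ᵢ ι J × (∀ k → 1 ℕ.≤ k → k ℕ.< m → ¬ (RI.∏ᵢ (V k) RI.⊆ᵢ ι J))
      μ-exists =
        let m , Vm⊆J , min = least (λ k → em (RI.∏ᵢ (V (suc k)) RI.⊆ᵢ ι J)) N λ z∈ →
              RP.⟨⟩-least (ι J) (ι-in {J} (K⊆J pivot-N∈K)) (∏V⊆⟨pivot⟩ (suc N) (V (suc N)) (V-isV (suc N)) z∈)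
        in suc m , s≤s z≤n , (λ {x} → Vm⊆J {x}) , λ { (suc k) _ (s≤s k<m) → min k<m }

      newton-μ : ∀ k → RI.∏ᵢ (V k) RI.⊆ᵢ ι J → ∀ {x} → x ∈ 𝒟 i → newton nodes k x ∈ ⟦ J ⟧
      newton-μ k V⊆J x∈𝒟 = +ᵢ-least {I = ⟨ pivot nodes k ⟩} {J = J} J (⟨⟩-least J (∏V⊆J⇒pivot∈J k V⊆J)) id
        (newton-divides k x∈𝒟)

-- Products of Newton polynomials in several variables: independence, spanning, polynomiality.

module Multivariate {c ℓ : Level} (D : CommutativeRing c ℓ) where
  open CommutativeRing D hiding (zero)
  open Ideals D
  open IdealProperties D
  open Newton D
  open IntegerSolver D using (solve; con; _:+_; _:*_; _:-_; :-_; _:=_)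
  open RawSemiringDefinitions (Semiring.rawSemiring semiring) using (_^_) renaming (product to ∏)
  open import Algebra.Properties.Semiring.Exp semiring using (^-homo-*)
  open import Relation.Binary.Reasoning.Setoid setoid

  module _ {a : Level} {X : Set a} where

    listSum : List X → (X → Carrier) → Carrier
    listSum []       h = 0#
    listSum (x ∷ xs) h = h x + listSum xs h

    listSum-cong : ∀ xs {h h′} → (∀ x → h x ≈ h′ x) → listSum xs h ≈ listSum xs h′
    listSum-cong []       e = refl
    listSum-cong (x ∷ xs) e = +-cong (e x) (listSum-cong xs e)

    listSum-++ : ∀ xs ys h → listSum (xs ++ ys) h ≈ listSum xs h + listSum ys h
    listSum-++ []       ys h = sym (+-identityˡ _)
    listSum-++ (x ∷ xs) ys h = trans (+-congˡ (listSum-++ xs ys h)) (sym (+-assoc _ _ _))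

    listSum-+ : ∀ xs h h′ → listSum xs (λ x → h x + h′ x) ≈ listSum xs h + listSum xs h′
    listSum-+ []       h h′ = sym (+-identityˡ 0#)
    listSum-+ (x ∷ xs) h h′ = trans (+-congˡ (listSum-+ xs h h′))
      (solve 4 (λ a b u v → (a :+ b) :+ (u :+ v) := (a :+ u) :+ (b :+ v)) refl (h x) (h′ x) _ _)

    listSum-* : ∀ xs d h → listSum xs (λ x → d * h x) ≈ d * listSum xs h
    listSum-* []       d h = sym (zeroʳ d)
    listSum-* (x ∷ xs) d h = trans (+-congˡ (listSum-* xs d h)) (sym (distribˡ d _ _))

  listSum-map : ∀ {a b} {X : Set a} {Y : Set b} (f : X → Y) xs h → listSum (List.map f xs) h ≡ listSum xs (h ∘ f)
  listSum-map f []       h = ≡.refl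
  listSum-map f (x ∷ xs) h = ≡.cong (h (f x) +_) (listSum-map f xs h)

  listSum-product : ∀ {a b c} {X : Set a} {Y : Set b} {Z : Set c} (f : X → Y → Z) xs ys h →
                    listSum (cartesianProductWith f xs ys) h ≈ listSum xs (λ x → listSum ys (h ∘ f x))
  listSum-product f []       ys h = refl
  listSum-product f (x ∷ xs) ys h = trans (listSum-++ (List.map (f x) ys) _ h)
    (+-cong (reflexive (listSum-map (f x) ys h)) (listSum-product f xs ys h))

  listSum-upTo : ∀ b a m x → listSum (upTo m) (λ k → a k * newton b k x) ≈ expand b a m x
  listSum-upTo b a zero    x = refl
  listSum-upTo b a (suc m) x = begin
    listSum (upTo (suc m)) h           ≈⟨ reflexive (≡.cong (λ ks → listSum ks h) (≡.sym (upTo-∷ʳ m))) ⟩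
    listSum (upTo m ++ m ∷ []) h       ≈⟨ listSum-++ (upTo m) (m ∷ []) h ⟩
    listSum (upTo m) h + (h m + 0#)    ≈⟨ +-cong (listSum-upTo b a m x) (+-identityʳ _) ⟩
    expand b a m x + h m               ∎
    where
      h : ℕ → Carrier
      h k = a k * newton b k x

  ∏-cong : ∀ {n} {s t : Vector Carrier n} → (∀ i → s i ≈ t i) → ∏ s ≈ ∏ t
  ∏-cong {zero}  e = refl
  ∏-cong {suc n} e = *-cong (e zero) (∏-cong (e ∘ suc))

  ∏-* : ∀ {n} (s t : Vector Carrier n) → ∏ (λ i → s i * t i) ≈ ∏ s * ∏ t
  ∏-* {zero}  s t = sym (*-identityˡ 1#)
  ∏-* {suc n} s t = trans (*-congˡ (∏-* (tail s) (tail t)))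
    (solve 4 (λ a b u v → (a :* b) :* (u :* v) := (a :* u) :* (b :* v)) refl (s zero) (t zero) _ _)

  ∏-1 : ∀ n → ∏ {n} (λ _ → 1#) ≈ 1#
  ∏-1 zero    = refl
  ∏-1 (suc n) = trans (*-identityˡ _) (∏-1 n)

  multinewton : ∀ {r} → (Fin r → ℕ → Carrier) → Vec ℕ r → Vector Carrier r → Carrier
  multinewton b k x = ∏ (λ i → newton (b i) (lookup k i) (x i))

  multipivot : ∀ {r} → (Fin r → ℕ → Carrier) → Vec ℕ r → Carrier
  multipivot b k = ∏ (λ i → pivot (b i) (lookup k i))

  multiexpand : ∀ {r} → (Fin r → ℕ → Carrier) → (Vec ℕ r → Carrier) → Vec ℕ r → Vector Carrier r → Carrier
  multiexpand b a μ x = listSum (box μ) (λ k → a k * multinewton b k x)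

  multinewton-cong : ∀ {r} (b : Fin r → ℕ → Carrier) k {x y} → (∀ i → x i ≈ y i) → multinewton b k x ≈ multinewton b k y
  multinewton-cong b k x≈y = ∏-cong (λ i → newton-cong (b i) (lookup k i) (x≈y i))

  multiexpand-congˣ : ∀ {r} (b : Fin r → ℕ → Carrier) a μ {x y} → (∀ i → x i ≈ y i) → multiexpand b a μ x ≈ multiexpand b a μ y
  multiexpand-congˣ b a μ x≈y = listSum-cong (box μ) λ k → *-congˡ (multinewton-cong b k x≈y)

  module _ {r} (b : Fin r → ℕ → Carrier) (μ : Vec ℕ r) (x : Vector Carrier r) where

    multiexpand-* : ∀ d a → multiexpand b (λ k → d * a k) μ x ≈ d * multiexpand b a μ x
    multiexpand-* d a = trans (listSum-cong (box μ) λ k → *-assoc _ _ _) (listSum-* (box μ) d _)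

    multiexpand-+ : ∀ a a′ → multiexpand b (λ k → a k + a′ k) μ x ≈ multiexpand b a μ x + multiexpand b a′ μ x
    multiexpand-+ a a′ = trans (listSum-cong (box μ) λ k → distribʳ _ _ _) (listSum-+ (box μ) _ _)

  -- An expansion in the first variable whose coefficients are expansions in the others; the
  -- inductions on the number of variables rest on it.
  multiexpand-∷ : ∀ {r} (b : Fin (suc r) → ℕ → Carrier) a m μ x → multiexpand b a (m Vec.∷ μ) x ≈
                  expand (b zero) (λ t → multiexpand (tail b) (λ k → a (t Vec.∷ k)) μ (tail x)) m (x zero)
  multiexpand-∷ b a m μ x = begin
    multiexpand b a (m Vec.∷ μ) x
      ≈⟨ listSum-product Vec._∷_ (upTo m) (box μ) _ ⟩
    listSum (upTo m) (λ t → listSum (box μ) (λ k → a (t Vec.∷ k) * (g t * multinewton (tail b) k (tail x))))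
      ≈⟨ listSum-cong (upTo m) (λ t → trans (listSum-cong (box μ) λ k →
           solve 3 (λ a g h → a :* (g :* h) := g :* (a :* h)) refl (a (t Vec.∷ k)) (g t) (multinewton (tail b) k (tail x)))
           (trans (listSum-* (box μ) (g t) _) (*-comm _ _))) ⟩
    listSum (upTo m) (λ t → multiexpand (tail b) (λ k → a (t Vec.∷ k)) μ (tail x) * g t)
      ≈⟨ listSum-upTo (b zero) _ m (x zero) ⟩
    expand (b zero) (λ t → multiexpand (tail b) (λ k → a (t Vec.∷ k)) μ (tail x)) m (x zero) ∎
    where
      g : ℕ → Carrier
      g t = newton (b zero) t (x zero)

  module _ (J : Ideal) {p : Level} where

    Independent : Pred Carrier p → (ℕ → Carrier) → Set (p ⊔ c ⊔ ℓ)
    Independent 𝒟 b = ∀ a m → (∀ {x} → x ∈ 𝒟 → expand b a m x ∈ ⟦ J ⟧) →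
                      ∀ {t} → t ℕ.< m → a t * pivot b t ∈ ⟦ J ⟧

    -- With the other variables frozen, independence in the first one puts each slice times its
    -- pivot into J. Absorbing that pivot into the coefficients leaves a null expansion in one
    -- variable fewer.
    multi-independent : ∀ {r} (𝒟 : Fin r → Pred Carrier p) b → (∀ i → Independent (𝒟 i) (b i)) →
                        ∀ a μ → (∀ x → (∀ i → x i ∈ 𝒟 i) → multiexpand b a μ x ∈ ⟦ J ⟧) →
                        ∀ {k} → k ∈ₗ box μ → a k * multipivot b k ∈ ⟦ J ⟧
    multi-independent {zero} 𝒟 b ind a Vec.[] null {Vec.[]} _ =
      ∈-resp J (sym (+-identityʳ _)) (null (λ ()) (λ ()))
    multi-independent {suc r} 𝒟 b ind a (m Vec.∷ μ) null k∈ = split (∈-cartesianProductWith⁻ Vec._∷_ (upTo m) (box μ) k∈)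
      where
        slice : ∀ t x → (∀ i → x i ∈ 𝒟 (suc i)) → t ℕ.< m →
                multiexpand (tail b) (λ k → a (t Vec.∷ k)) μ x * pivot (b zero) t ∈ ⟦ J ⟧
        slice t x x∈ t<m = ind zero (λ t → multiexpand (tail b) (λ k → a (t Vec.∷ k)) μ x) m
          (λ {x₀} x₀∈ → ∈-resp J (sym (multiexpand-∷ b a m μ (x₀ ∷ᶠ x)))
            (null (x₀ ∷ᶠ x) λ { zero → x₀∈ ; (suc i) → x∈ i })) t<m

        split : ∀ {k} → ∃[ t ] ∃[ k′ ] t ∈ₗ upTo m × k′ ∈ₗ box μ × k ≡ t Vec.∷ k′ → a k * multipivot b k ∈ ⟦ J ⟧
        split (t , k′ , t∈ , k′∈ , ≡.refl) = ∈-resp J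
          (solve 3 (λ a π π′ → a :* (π :* π′) := (π :* a) :* π′) refl (a (t Vec.∷ k′)) (pivot (b zero) t) (multipivot (tail b) k′))
          (multi-independent (tail 𝒟) (tail b) (ind ∘ suc) (λ k → pivot (b zero) t * a (t Vec.∷ k)) μ
            (λ x x∈ → ∈-resp J (trans (multiexpand-* (tail b) μ x _ _) (*-comm _ _)) (slice t x x∈ (∈-upTo⁻ t∈))) k′∈)

    δ₀ : ℕ → Carrier
    δ₀ zero    = 1#
    δ₀ (suc _) = 0#

    expand-1 : ∀ b m x → expand b δ₀ (suc m) x ≈ 1#
    expand-1 b zero    x = solve 0 (con 0ℤ :+ con 1ℤ :* con 1ℤ := con 1ℤ) refl
    expand-1 b (suc m) x = trans (+-cong (expand-1 b m x) (zeroˡ _)) (+-identityʳ 1#)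

    module _ (𝒟 : Pred Carrier p) (b : ℕ → Carrier) (m : ℕ)
             (vanish : ∀ {x} → x ∈ 𝒟 → newton b (suc m) x ∈ ⟦ J ⟧) where

      power-expand : ∀ k → Σ (ℕ → Carrier) λ a → ∀ {x} → x ∈ 𝒟 → x ^ k ≈[ J ] expand b a (suc m) x
      power-expand zero    = δ₀ , λ {x} _ → ≈⇒≈[] J (sym (expand-1 b m x))
      power-expand (suc k) = let a , eq = power-expand k in
        (λ j → shift a j + b j * a j) , λ {x} x∈ → Mod.trans J
          (Mod.trans J (Mod.*-congˡ J {x} (eq x∈)) (≈⇒≈[] J (x*expand b a (suc m) x)))
          -- The overflow of `x*expand` is a_m N_{m+1}(x), which lies in J by `vanish`; degrees stay
          -- below `suc m`.
          (∈-resp J (solve 2 (λ u v → (u :+ v) :- u := v) refl _ _) (Ideal.*-closed J (a m) (vanish x∈)))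

    monomial-expand : ∀ {r} (𝒟 : Fin r → Pred Carrier p) b μ → (∀ i → 1 ℕ.≤ lookup μ i) →
                      (∀ i {x} → x ∈ 𝒟 i → newton (b i) (lookup μ i) x ∈ ⟦ J ⟧) → ∀ k →
                      Σ (Vec ℕ r → Carrier) λ a → ∀ x → (∀ i → x i ∈ 𝒟 i) →
                      ∏ (λ i → x i ^ lookup k i) ≈[ J ] multiexpand b a μ x
    monomial-expand {zero} 𝒟 b Vec.[] 1≤μ vanish k = (λ _ → 1#) , λ x _ → ≈⇒≈[] J
      (solve 0 (con 1ℤ := con 1ℤ :* con 1ℤ :+ con 0ℤ) refl)
    monomial-expand {suc r} 𝒟 b (zero Vec.∷ μ) 1≤μ = case 1≤μ zero of λ ()
    monomial-expand {suc r} 𝒟 b (suc m Vec.∷ μ) 1≤μ vanish (k₀ Vec.∷ k) =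
      let a₀ , eq₀ = power-expand (𝒟 zero) (b zero) m (vanish zero) k₀
          a  , eq  = monomial-expand (tail 𝒟) (tail b) μ (1≤μ ∘ suc) (λ i → vanish (suc i)) k
      in (λ k → a₀ (Vec.head k) * a (Vec.tail k)) , λ x x∈ → Mod.trans J (Mod.*-cong J (eq₀ (x∈ zero)) (eq (tail x) (x∈ ∘ suc)))
        (≈⇒≈[] J (sym (begin
          multiexpand b (λ k → a₀ (Vec.head k) * a (Vec.tail k)) (suc m Vec.∷ μ) x
            ≈⟨ multiexpand-∷ b _ (suc m) μ x ⟩
          expand (b zero) (λ t → multiexpand (tail b) (λ k → a₀ t * a k) μ (tail x)) (suc m) (x zero)
            ≈⟨ expand-cong (b zero) (suc m) (x zero) (λ t → trans (multiexpand-* (tail b) μ (tail x) (a₀ t) a) (*-comm _ _)) ⟩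
          expand (b zero) (λ t → multiexpand (tail b) a μ (tail x) * a₀ t) (suc m) (x zero)
            ≈⟨ expand-* (b zero) _ a₀ (suc m) (x zero) ⟩
          multiexpand (tail b) a μ (tail x) * expand (b zero) a₀ (suc m) (x zero)
            ≈⟨ *-comm _ _ ⟩
          expand (b zero) a₀ (suc m) (x zero) * multiexpand (tail b) a μ (tail x) ∎)))

    polynomial-expand : ∀ {r} (𝒟 : Fin r → Pred Carrier p) b μ → (∀ i → 1 ℕ.≤ lookup μ i) →
                        (∀ i {x} → x ∈ 𝒟 i → newton (b i) (lookup μ i) x ∈ ⟦ J ⟧) → ∀ F →
                        Σ (Vec ℕ r → Carrier) λ a → ∀ x → (∀ i → x i ∈ 𝒟 i) → eval F x ≈[ J ] multiexpand b a μ x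
    -- The zero coefficient is spelled as a product so that `multiexpand-*` applies to it directly.
    polynomial-expand 𝒟 b μ 1≤μ vanish [] = (λ _ → 0# * 0#) , λ x _ →
      ≈⇒≈[] J (sym (trans (multiexpand-* b μ x 0# (λ _ → 0#)) (zeroˡ _)))
    polynomial-expand 𝒟 b μ 1≤μ vanish ((d , k) ∷ F) =
      let a  , eq  = monomial-expand 𝒟 b μ 1≤μ vanish k
          a′ , eq′ = polynomial-expand 𝒟 b μ 1≤μ vanish F
      in (λ k → d * a k + a′ k) , λ x x∈ → Mod.trans J (Mod.+-cong J (Mod.*-congˡ J {d} (eq x x∈)) (eq′ x x∈))
        (≈⇒≈[] J (sym (trans (multiexpand-+ b μ x _ _) (+-congʳ (multiexpand-* b μ x d a)))))

  module _ {r : ℕ} where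

    -- Closure properties of this class supply a term list for `multiexpand` without an explicit
    -- formula for its coefficients.
    IsPolynomial : (Vector Carrier r → Carrier) → Set (c ⊔ ℓ)
    IsPolynomial f = Σ (MvPolynomial r) λ F → ∀ x → eval F x ≈ f x

    monomial : Vec ℕ r → Vector Carrier r → Carrier
    monomial k x = ∏ (λ i → x i ^ lookup k i)

    monomial-+ : ∀ k k′ x → monomial (Vec.zipWith ℕ._+_ k k′) x ≈ monomial k x * monomial k′ x
    monomial-+ k k′ x = trans
      (∏-cong λ i → trans (reflexive (≡.cong (x i ^_) (lookup-zipWith ℕ._+_ i k k′))) (^-homo-* (x i) (lookup k i) (lookup k′ i)))
      (∏-* (λ i → x i ^ lookup k i) (λ i → x i ^ lookup k′ i))

    isPolynomial-cong : ∀ {f g} → (∀ x → f x ≈ g x) → IsPolynomial f → IsPolynomial g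
    isPolynomial-cong f≈g (F , e) = F , λ x → trans (e x) (f≈g x)

    isPolynomial-0 : IsPolynomial (λ _ → 0#)
    isPolynomial-0 = [] , λ _ → refl

    isPolynomial-term : ∀ d k → IsPolynomial (λ x → d * monomial k x)
    isPolynomial-term d k = (d , k) ∷ [] , λ x → +-identityʳ _

    isPolynomial-const : ∀ d → IsPolynomial (λ _ → d)
    isPolynomial-const d = isPolynomial-cong
      (λ x → trans (*-congˡ (trans (∏-cong λ i → reflexive (≡.cong (x i ^_) (lookup-replicate i 0))) (∏-1 r))) (*-identityʳ d))
      (isPolynomial-term d (Vec.replicate r 0))

    eval-++ : ∀ F G x → eval {r} (F ++ G) x ≈ eval F x + eval G x
    eval-++ []            G x = sym (+-identityˡ _)
    eval-++ ((d , k) ∷ F) G x = trans (+-congˡ (eval-++ F G x)) (sym (+-assoc _ _ _))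

    isPolynomial-+ : ∀ {f g} → IsPolynomial f → IsPolynomial g → IsPolynomial (λ x → f x + g x)
    isPolynomial-+ (F , e) (G , e′) = F ++ G , λ x → trans (eval-++ F G x) (+-cong (e x) (e′ x))

    isPolynomial-term* : ∀ d k F → IsPolynomial (λ x → (d * monomial k x) * eval F x)
    isPolynomial-term* d k []              = isPolynomial-cong (λ x → sym (zeroʳ _)) isPolynomial-0
    isPolynomial-term* d k ((d′ , k′) ∷ F) = isPolynomial-cong
      (λ x → trans (+-congʳ (trans (*-congˡ (monomial-+ k k′ x))
                 (solve 4 (λ d d′ m m′ → (d :* d′) :* (m :* m′) := (d :* m) :* (d′ :* m′)) refl d d′ (monomial k x) (monomial k′ x))))
               (sym (distribˡ _ _ _)))
      (isPolynomial-+ (isPolynomial-term (d * d′) (Vec.zipWith ℕ._+_ k k′)) (isPolynomial-term* d k F))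

    isPolynomial-eval* : ∀ F G → IsPolynomial (λ x → eval F x * eval G x)
    isPolynomial-eval* []            G = isPolynomial-cong (λ x → sym (zeroˡ _)) isPolynomial-0
    isPolynomial-eval* ((d , k) ∷ F) G = isPolynomial-cong (λ x → sym (distribʳ _ _ _))
      (isPolynomial-+ (isPolynomial-term* d k G) (isPolynomial-eval* F G))

    isPolynomial-* : ∀ {f g} → IsPolynomial f → IsPolynomial g → IsPolynomial (λ x → f x * g x)
    isPolynomial-* (F , e) (G , e′) = isPolynomial-cong (λ x → *-cong (e x) (e′ x)) (isPolynomial-eval* F G)

  unitVec : ∀ {r} → Fin r → Vec ℕ r
  unitVec {suc r} zero    = 1 Vec.∷ Vec.replicate r 0
  unitVec         (suc i) = 0 Vec.∷ unitVec i

  monomial-unitVec : ∀ {r} i (x : Vector Carrier r) → monomial (unitVec i) x ≈ x i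
  monomial-unitVec {suc r} zero    x = trans
    (*-cong (*-identityʳ _) (trans (∏-cong λ i → reflexive (≡.cong (x (suc i) ^_) (lookup-replicate i 0))) (∏-1 r))) (*-identityʳ _)
  monomial-unitVec         (suc i) x = trans (*-identityˡ _) (monomial-unitVec i (tail x))

  isPolynomial-var : ∀ {r} (i : Fin r) → IsPolynomial (λ x → x i)
  isPolynomial-var i = isPolynomial-cong (λ x → trans (*-identityˡ _) (monomial-unitVec i x)) (isPolynomial-term 1# (unitVec i))

  isPolynomial-newton : ∀ {r} b k (i : Fin r) → IsPolynomial (λ x → newton b k (x i))
  isPolynomial-newton b zero    i = isPolynomial-const 1#
  isPolynomial-newton b (suc k) i = isPolynomial-* (isPolynomial-newton b k i)
    (isPolynomial-+ (isPolynomial-var i) (isPolynomial-const (- b k)))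

  isPolynomial-∏ : ∀ {r n} (f : Fin n → Vector Carrier r → Carrier) → (∀ i → IsPolynomial (f i)) →
                   IsPolynomial (λ x → ∏ (λ i → f i x))
  isPolynomial-∏ {n = zero}  f p = isPolynomial-const 1#
  isPolynomial-∏ {n = suc n} f p = isPolynomial-* (p zero) (isPolynomial-∏ (f ∘ suc) (p ∘ suc))

  isPolynomial-listSum : ∀ {r a} {X : Set a} (xs : List X) (f : X → Vector Carrier r → Carrier) →
                         (∀ k → IsPolynomial (f k)) → IsPolynomial (λ x → listSum xs (λ k → f k x))
  isPolynomial-listSum []       f p = isPolynomial-0
  isPolynomial-listSum (k ∷ ks) f p = isPolynomial-+ (p k) (isPolynomial-listSum ks f p)

  isPolynomial-multiexpand : ∀ {r} (b : Fin r → ℕ → Carrier) a μ → IsPolynomial (multiexpand b a μ)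
  isPolynomial-multiexpand b a μ = isPolynomial-listSum (box μ) _ λ k → isPolynomial-* (isPolynomial-const (a k))
    (isPolynomial-∏ _ λ i → isPolynomial-newton (b i) (lookup k i) i)

-- Cardinalities of finite setoids and of families indexed by a list.

box-unique : ∀ {r} (μ : Vec ℕ r) → Unique (box μ)
box-unique Vec.[]       = All.[] ∷ []
box-unique (m Vec.∷ μ) = cartesianProductWith⁺ Vec._∷_ ∷-injective (upTo⁺ m) (box-unique μ)

module _ {a ℓ : Level} (S : Setoid a ℓ) where
  open Setoid S

  HasCardinality-fromFin : ∀ {n} (g : Fin n → Carrier) → (∀ {i j} → g i ≈ g j → i ≡ j) →
                           (∀ x → ∃[ i ] g i ≈ x) → HasCardinality S n
  HasCardinality-fromFin {n} g injective surjective = Symmetry.inverse (Bijection⇒Inverse bijection)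
    where
      bijection : Bijection (≡ₚ.setoid (Fin n)) S
      bijection = record
        { to        = g
        ; cong      = reflexive ∘ ≡.cong g
        ; bijective = injective , λ x → proj₁ (surjective x) , λ { ≡.refl → proj₂ (surjective x) }
        }

  removeDuplicates : Decidable _≈_ → ∀ {n} (f : Fin n → Carrier) →
    ∃[ m ] Σ (Fin m → Carrier) λ g → (∀ {i j} → g i ≈ g j → i ≡ j) × (∀ i → ∃[ j ] g j ≈ f i)
  removeDuplicates _≈?_ {zero} f = 0 , (λ ()) , (λ {}) , λ ()
  removeDuplicates _≈?_ {suc n} f with removeDuplicates _≈?_ (tail f)
  ... | m , g , injective , covers with Fin.any? (λ j → g j ≈? f zero)
  ...   | yes p = m , g , injective , λ { zero → p ; (suc i) → covers i }
  ...   | no ¬p = suc m , (f zero ∷ᶠ g) , injective′ _ _ , λ { zero → zero , refl ; (suc i) → let j , e = covers i in suc j , e }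
    where
      injective′ : ∀ i j → (f zero ∷ᶠ g) i ≈ (f zero ∷ᶠ g) j → i ≡ j
      injective′ zero    zero    e = ≡.refl
      injective′ zero    (suc j) e = contradiction (j , sym e) ¬p
      injective′ (suc i) zero    e = contradiction (i , e) ¬p
      injective′ (suc i) (suc j) e = ≡.cong suc (injective e)

  hasCardinality : Decidable _≈_ → ∀ {n} (f : Fin n → Carrier) → (∀ x → ∃[ i ] f i ≈ x) → ∃[ m ] HasCardinality S m
  hasCardinality _≈?_ f surjective =
    let m , g , injective , covers = removeDuplicates _≈?_ f
    in m , HasCardinality-fromFin g injective λ x →
         let i , fi≈x = surjective x
             j , gj≈fi = covers i
         in j , trans gj≈fi fi≈x

module _ {a s ℓ : Level} {A : Set a} (_≟_ : DecidableEquality A) (F : A → Setoid s ℓ)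
         (point : ∀ k → Setoid.Carrier (F k)) where
  private module F k = Setoid (F k)

  -- Families are indexed by all of A, but only their members in ks are compared.
  Families : List A → Setoid (a ⊔ s) (a ⊔ ℓ)
  Families ks = record
    { Carrier       = ∀ k → F.Carrier k
    ; _≈_           = λ x y → ∀ {k} → k ∈ₗ ks → F._≈_ k (x k) (y k)
    ; isEquivalence = record
      { refl  = λ {_} {k} _ → F.refl k
      ; sym   = λ e {k} k∈ → F.sym k (e k∈)
      ; trans = λ e e′ {k} k∈ → F.trans k (e k∈) (e′ k∈)
      }
    }

  module _ (card : A → ℕ) (F-card : ∀ k → HasCardinality (F k) (card k)) where

    private
      update : ∀ k → F.Carrier k → (∀ k → F.Carrier k) → ∀ k → F.Carrier k
      update k x y k′ with k ≟ k′
      ... | yes ≡.refl = x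
      ... | no _       = y k′

      update-same : ∀ k x y → update k x y k ≡ x
      update-same k x y with k ≟ k
      ... | yes ≡.refl = ≡.refl
      ... | no k≢k     = contradiction ≡.refl k≢k

      update-other : ∀ k x y {k′} → k ≢ k′ → update k x y k′ ≡ y k′
      update-other k x y {k′} k≢k′ with k ≟ k′
      ... | yes k≡k′ = contradiction k≡k′ k≢k′
      ... | no _     = ≡.refl

      -- Mixed-radix digits: `remQuot` splits off the member at the head of the list, and `point`
      -- fills the places outside the list. Without repetitions, later digits cannot be overwritten
      -- by earlier ones.
      decode : ∀ ks → Fin (product (List.map card ks)) → ∀ k → F.Carrier k
      insert : ∀ k ks → Fin (card k) × Fin (product (List.map card ks)) → ∀ k → F.Carrier k

      decode []       _ = point
      decode (k ∷ ks) i = insert k ks (remQuot (product (List.map card ks)) i)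

      insert k ks (i , j) = update k (Inverse.from (F-card k) i) (decode ks j)

      from-injective : ∀ k {i j} → F._≈_ k (Inverse.from (F-card k) i) (Inverse.from (F-card k) j) → i ≡ j
      from-injective k {i} {j} e = ≡.trans (≡.sym (Inverse.strictlyInverseˡ (F-card k) i))
        (≡.trans (Inverse.to-cong (F-card k) e) (Inverse.strictlyInverseˡ (F-card k) j))

      decode-injective : ∀ ks → Unique ks → ∀ {i j} → Setoid._≈_ (Families ks) (decode ks i) (decode ks j) → i ≡ j
      decode-injective []       _            {zero} {zero} _ = ≡.refl
      decode-injective (k ∷ ks) (k∉ks ∷ u) {i} {j} e = ≡.trans (≡.sym (Fin.combine-remQuot {card k} m i))
        (≡.trans (≡.cong₂ combine
          (from-injective k (≡.subst₂ (F._≈_ k) (update-same k _ _) (update-same k _ _) (e (here ≡.refl))))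
          (decode-injective ks u λ {k′} k′∈ → ≡.subst₂ (F._≈_ k′)
            (update-other k _ _ (All.lookup k∉ks k′∈)) (update-other k _ _ (All.lookup k∉ks k′∈)) (e (there k′∈))))
          (Fin.combine-remQuot {card k} m j))
        where m = product (List.map card ks)

      decode-surjective : ∀ ks → Unique ks → ∀ x → ∃[ i ] Setoid._≈_ (Families ks) (decode ks i) x
      decode-surjective []       _          x = zero , λ ()
      decode-surjective (k ∷ ks) (k∉ks ∷ u) x = combine i j , agree _ (Fin.remQuot-combine i j)
        where
          m = product (List.map card ks)
          i = Inverse.to (F-card k) (x k)
          j = proj₁ (decode-surjective ks u x)

          -- The pair is generalised because `remQuot` of `combine` equals (i , j) only
          -- propositionally.
          agree : ∀ p → p ≡ (i , j) → ∀ {k′} → k′ ∈ₗ k ∷ ks → F._≈_ k′ (insert k ks p k′) (x k′)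
          agree _ ≡.refl (here ≡.refl)    = F.trans k (F.reflexive k (update-same k _ _)) (Inverse.strictlyInverseʳ (F-card k) (x k))
          agree _ ≡.refl {k′} (there k′∈) = F.trans k′ (F.reflexive k′ (update-other k _ _ (All.lookup k∉ks k′∈)))
            (proj₂ (decode-surjective ks u x) k′∈)

    families-cardinality : ∀ ks → Unique ks → HasCardinality (Families ks) (product (List.map card ks))
    families-cardinality ks u = HasCardinality-fromFin (Families ks) (decode ks)
      (λ {i} {j} → decode-injective ks u {i} {j}) (decode-surjective ks u)

-- Bijection between polynomial functions and families of factor elements.

module Counting {c ℓ : Level} (D : CommutativeRing c ℓ) (dedekind : Ideals.IsDedekindDomain D)
                (fnp : Ideals.FiniteNormProperty D) (S : Setting D) where
  open CommutativeRing D hiding (zero)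
  open Ideals D
  open IdealProperties D
  open Newton D
  open Multivariate D
  open Setting S
  open PrimaryComponents D dedekind fnp S
  open Orderings D dedekind fnp S
  open IntegerSolver D using (solve; con; _:+_; _:*_; _:-_; :-_; _:=_)

  -- The greedy orderings realise all the v_k, so a count stated for every such family is not
  -- vacuous.
  vFamily-exists : ∃[ v ] IsVFamily S v
  vFamily-exists = (λ i k l → proj₁ (isV-exists i l k)) , λ i k l → proj₂ (isV-exists i l k)

  module _ (v : VFamily S) (v-isV : IsVFamily S v) where

    μ-spec : ∀ i → ∃[ m ] 1 ℕ.≤ m × vₖ S v i m RI.⊆ᵢ ι J × (∀ k → 1 ℕ.≤ k → k ℕ.< m → ¬ (vₖ S v i k RI.⊆ᵢ ι J))
    μ-spec i = μ-exists i (v i) (v-isV i)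

    μ : Vec ℕ r
    μ = Vec.tabulate (proj₁ ∘ μ-spec)

    μ-first : ∀ i → 1 ℕ.≤ lookup μ i × vₖ S v i (lookup μ i) RI.⊆ᵢ ι J ×
              (∀ k → 1 ℕ.≤ k → k ℕ.< lookup μ i → ¬ (vₖ S v i k RI.⊆ᵢ ι J))
    μ-first i = ≡.subst (λ m → 1 ℕ.≤ m × vₖ S v i m RI.⊆ᵢ ι J × (∀ k → 1 ℕ.≤ k → k ℕ.< m → ¬ (vₖ S v i k RI.⊆ᵢ ι J)))
      (≡.sym (lookup∘tabulate (proj₁ ∘ μ-spec) i)) (proj₂ (μ-spec i))

    π : Vec ℕ r → Carrier
    π = multipivot nodes

    numerator : Vec ℕ r → RI.Ideal
    numerator k = RI.∏ᵢ (λ i → vₖ S v i (lookup k i)) RI.+ᵢ ι J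

    π∈numerator : ∀ k → π k ∈ RI.⟦ numerator k ⟧
    π∈numerator k = RP.+ᵢ-inˡ ∏v (ι J)
        (RP.∏ᵢ-in {A = λ i → vₖ S v i (lookup k i)} λ i → pivot∈∏V i (lookup k i) (v i (lookup k i)) (v-isV i (lookup k i)))
      where ∏v = RI.∏ᵢ (λ i → vₖ S v i (lookup k i))

    multiple : ∀ k → Carrier → Setoid.Carrier (Factor S v k)
    multiple k t = t * π k , RI.Ideal.*-closed (numerator k) t (π∈numerator k)

    coefficient : ∀ k (z : Setoid.Carrier (Factor S v k)) → ∃[ t ] proj₁ z ≈[ J ] t * π k
    coefficient k (z , x , y , x∈ , y∈ , z∼) =
      let lift (t , x∼tπ) = RP.∏ᵢ-⊆⟨⟩ {a = λ i → pivot (nodes i) (lookup k i)}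
            (λ i → ∏V⊆⟨pivot⟩ i (lookup k i) (v i (lookup k i)) (v-isV i (lookup k i))) x∈
      in t , Mod.trans J (K⊆J z∼) (Mod.trans J (Mod.+-cong J (K⊆J x∼tπ) (∈⇒≈[]0 J (ι-out J K⊆J y∈)))
               (Mod.+-identityʳ J (t * π k)))

    factor-finite : ∀ k → ∃[ m ] HasCardinality (Factor S v k) m
    factor-finite k = hasCardinality (Factor S v k) (λ _ _ → em _) f surjective
      where
        finite-J = fnp J J≠0
        open Residues D J (proj₂ finite-J)

        f : Fin (proj₁ finite-J) → Setoid.Carrier (Factor S v k)
        f t = case em (rep t ∈ RI.⟦ numerator k ⟧) of λ where
          (yes p) → rep t , p
          (no _)  → 0# , RI.Ideal.0∈ (numerator k)

        f-rep : ∀ t → rep t ∈ RI.⟦ numerator k ⟧ → proj₁ (f t) ≡ rep t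
        f-rep t p with em (rep t ∈ RI.⟦ numerator k ⟧)
        ... | yes _ = ≡.refl
        ... | no ¬p = contradiction p ¬p

        surjective : ∀ z → ∃[ t ] Setoid._≈_ (Factor S v k) (f t) z
        surjective (z , z∈) = index z , ι-in {J} (≡.subst (_≈[ J ] z) (≡.sym (f-rep (index z) rep∈)) rep≈)
          where
            rep≈ : rep (index z) ≈[ J ] z
            rep≈ = Mod.sym J (≈rep z)

            -- The numerator contains J̄, so it contains the whole class of z modulo J, and the
            -- default `0#` in `f` is not reached here.
            rep∈ : rep (index z) ∈ RI.⟦ numerator k ⟧
            rep∈ = ∈-resp-≈[] (κ (numerator k)) (RP.+ᵢ-inʳ (RI.∏ᵢ (λ i → vₖ S v i (lookup k i))) (ι J) (ι-in {J} rep≈)) z∈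

    card : Vec ℕ r → ℕ
    card k = proj₁ (factor-finite k)

    N-is : IsN S v (product (List.map card (box μ)))
    N-is = μ , inj₁ ∘ μ-first , card , (λ k → proj₂ (factor-finite k)) , ≡.refl

    InDomain : Vector Carrier r → Set (c ⊔ ℓ)
    InDomain x = ∀ i → x i ∈ 𝒟 i

    -- On the residues each basis product is a multiple of π_k modulo J, so whatever annihilates π_k
    -- modulo J annihilates the basis product. The choice of t in `coefficient` is thereby
    -- immaterial.
    multiexpand-≈[] : ∀ {a a′} → (∀ {k} → k ∈ₗ box μ → a k * π k ≈[ J ] a′ k * π k) →
                      ∀ x → InDomain x → multiexpand nodes a μ x ≈[ J ] multiexpand nodes a′ μ x
    multiexpand-≈[] {a} {a′} eq x x∈ = go (box μ) eq
      where
        go : ∀ ks → (∀ {k} → k ∈ₗ ks → a k * π k ≈[ J ] a′ k * π k) →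
             listSum ks (λ k → a k * multinewton nodes k x) ≈[ J ] listSum ks (λ k → a′ k * multinewton nodes k x)
        go []       eq = Mod.refl J
        go (k ∷ ks) eq = Mod.+-cong J
          (∈-resp J (solve 3 (λ a a′ g → a :* g :- a′ :* g := (a :- a′) :* g) refl (a k) (a′ k) (multinewton nodes k x))
            (*∈-⟨⟩+ J (a k - a′ k) (π k)
              (∈-resp J (solve 3 (λ a a′ g → (a :- a′) :* g := a :* g :- a′ :* g) refl (a k) (a′ k) (π k)) (eq (here ≡.refl)))
              (∏∈⟨∏⟩+ J (λ i → newton (nodes i) (lookup k i) (x i)) (λ i → pivot (nodes i) (lookup k i))
                λ i → newton-divides i (lookup k i) (x∈ i))))
          (go ks (eq ∘ there))

    -- Independence is applied to the difference of the coefficients, written with the factor `- 1#`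
    -- so that additivity and homogeneity of `multiexpand` suffice.
    multiexpand-injective : ∀ {a a′} → (∀ x → InDomain x → multiexpand nodes a μ x ≈[ J ] multiexpand nodes a′ μ x) →
                            ∀ {k} → k ∈ₗ box μ → a k * π k ≈[ J ] a′ k * π k
    multiexpand-injective {a} {a′} eq {k} k∈ = ∈-resp J
      (solve 3 (λ a a′ g → a :* g :- a′ :* g := (a :+ (:- con 1ℤ) :* a′) :* g) refl (a k) (a′ k) (π k))
      (multi-independent J 𝒟 nodes newton-independent (λ k → a k + (- 1#) * a′ k) μ
        (λ x x∈ → ∈-resp J
          (trans (multiexpand-+ nodes μ x _ _) (trans (+-congˡ (multiexpand-* nodes μ x (- 1#) a′))
            (solve 2 (λ s t → s :+ (:- con 1ℤ) :* t := s :- t) refl (multiexpand nodes a μ x) (multiexpand nodes a′ μ x))))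
          (eq x x∈)) k∈)

    FactorFamilies : Setoid (c ⊔ ℓ) (c ⊔ ℓ)
    FactorFamilies = Families (≡-dec ℕ._≟_) (Factor S v) (λ k → multiple k 0#) (box μ)

    coefficients : Setoid.Carrier FactorFamilies → Vec ℕ r → Carrier
    coefficients z k = proj₁ (coefficient k (z k))

    toFunction : Setoid.Carrier FactorFamilies → Setoid.Carrier (PolynomialFunctions S)
    toFunction z = f , proj₁ poly , λ (x , _) → ≈⇒≈[] J (proj₂ poly x)
      where
        f : Func (Domain S) (Codomain S)
        f = record
          { to   = λ (x , _) → multiexpand nodes (coefficients z) μ x
          ; cong = λ x≈y → ≈⇒≈[] J (multiexpand-congˣ nodes (coefficients z) μ x≈y)
          }

        poly : IsPolynomial (multiexpand nodes (coefficients z) μ)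
        poly = isPolynomial-multiexpand nodes (coefficients z) μ

    toFunction-bijection : Bijection FactorFamilies (PolynomialFunctions S)
    toFunction-bijection = record
      { to        = toFunction
      ; cong      = λ {z} {z′} → cong z z′
      ; bijective = (λ {z} {z′} → injective z z′) , λ F → proj₁ (surjective F) , λ {z} z≈ → 
          trans-PF (toFunction z) (toFunction (proj₁ (surjective F))) F (cong z (proj₁ (surjective F)) z≈) (proj₂ (surjective F))
      }
      where
        trans-PF : ∀ F G H → Setoid._≈_ (PolynomialFunctions S) F G → Setoid._≈_ (PolynomialFunctions S) G H →
                   Setoid._≈_ (PolynomialFunctions S) F H
        trans-PF F G H = Setoid.trans (PolynomialFunctions S) {F} {G} {H}

        cong : ∀ z z′ → Setoid._≈_ FactorFamilies z z′ → Setoid._≈_ (PolynomialFunctions S) (toFunction z) (toFunction z′)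
        cong z z′ z≈z′ (x , x∈) = multiexpand-≈[] (λ {k} k∈ → Mod.trans J (Mod.sym J (proj₂ (coefficient k (z k))))
          (Mod.trans J (ι-out J K⊆J (z≈z′ k∈)) (proj₂ (coefficient k (z′ k))))) x x∈

        injective : ∀ z z′ → Setoid._≈_ (PolynomialFunctions S) (toFunction z) (toFunction z′) → Setoid._≈_ FactorFamilies z z′
        injective z z′ eq {k} k∈ = ι-in {J} (Mod.trans J (proj₂ (coefficient k (z k)))
          (Mod.trans J (multiexpand-injective (λ x x∈ → eq (x , x∈)) k∈) (Mod.sym J (proj₂ (coefficient k (z′ k))))))

        surjective : ∀ F → Σ (Setoid.Carrier FactorFamilies) λ z → Setoid._≈_ (PolynomialFunctions S) (toFunction z) F
        surjective (f , F , F≈f) =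
          let a , eq = polynomial-expand J 𝒟 nodes μ (proj₁ ∘ μ-first)
                (λ i → newton-μ i (v i) (v-isV i) (lookup μ i) (proj₁ (proj₂ (μ-first i)))) F
          -- `coefficient` may recover from a_k π_k a number other than a_k, but the products with
          -- π_k agree modulo J.
          in (λ k → multiple k (a k)) , λ (x , x∈) → Mod.trans J
            (multiexpand-≈[] (λ {k} _ → Mod.sym J (proj₂ (coefficient k (multiple k (a k))))) x x∈)
            (Mod.trans J (Mod.sym J (eq x x∈)) (F≈f (x , x∈)))

    polynomialFunctions-cardinality : HasCardinality (PolynomialFunctions S) (product (List.map card (box μ)))
    polynomialFunctions-cardinality = Composition.inverse
      (Symmetry.inverse (Bijection⇒Inverse toFunction-bijection))
      (families-cardinality (≡-dec ℕ._≟_) (Factor S v) (λ k → multiple k 0#) card (λ k → proj₂ (factor-finite k)) (box μ) (box-unique μ))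

mainTheorem6 : ∀ {c ℓ} (D : CommutativeRing c ℓ) →
    Ideals.IsDedekindDomain D → Ideals.FiniteNormProperty D → (S : Setting D) →
    (∃[ v ] IsVFamily S v) ×
    (∀ v → IsVFamily S v → ∃[ N ] IsN S v N × HasCardinality (PolynomialFunctions S) N)
mainTheorem6 D dedekind fnp S = vFamily-exists , λ v v-isV → _ , N-is v v-isV , polynomialFunctions-cardinality v v-isV
  where open Counting D dedekind fnp S
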